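{- Let $G$ be a bridgeless planar ribbon graph with planar dual ribbon graph $G^\star$. Let $\beta$ and $\beta^\star$ denote the canonical Bernardi actions of $\operatorname{Pic}^0(G)$ on $S(G)$ and of $\operatorname{Pic}^0(G^\star)$ on $S(G^\star)$, respectively. Then for all $\gamma \in \operatorname{Pic}^0(G)$ and $T \in S(G)$, \[ \sigma(\beta(\gamma, T)) = \beta^\star(\Psi(\gamma), \sigma(T)), \] i.e. the diagram with rows $\beta : \operatorname{Pic}^0(G) \times S(G) \to S(G)$ and $\beta^\star : \operatorname{Pic}^0(G^\star)\times S(G^\star) \to S(G^\star)$ and vertical maps $\Psi \times \sigma$ and $\sigma$ commutes.
   Context: A graph means a finite connected multigraph without loop edges; a ribbon graph is a graph with a cyclic ordering of the edges around each vertex. $G$ is a planar ribbon graph if it is embedded in $\mathbb{R}^2$ without crossings with cyclic orderings induced by the counterclockwise orientation. A bridge is an edge whose removal disconnects the graph. The planar dual $G^\star$ has a vertex for each face of the embedding and an edge $e^\star$ crossing each edge $e$ of $G$; its ribbon structure is the one induced by the opposite (clockwise) orientation of the plane. $S(G)$ is the set of spanning trees; $\sigma : S(G) \to S(G^\star)$ sends $T$ to the spanning tree whose edges are the duals of the edges of $G$ not in $T$. Divisors, $\Delta f = \sum_u \big(\sum_{\text{edges } uw}(f(u)-f(w))\big)(u)$, linear equivalence ($D\sim D'$ iff $D-D'=\Delta f$), and $\operatorname{Pic}^d$ (classes of degree-$d$ divisors) are as usual; $\operatorname{Pic}^0$ is a group. Directed edges of $G$ are identified with directed edges of $G^\star$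 by orienting $e^\star$ from the orientation of $e$ by following the orientation of the plane locally at the crossing; this gives an isomorphism $c \mapsto c^\star$ between integral $1$-chains on $G$ and on $G^\star$. With $\partial$ the boundary map from $1$-chains to degree-$0$ divisors (a directed edge $(x,y)$ maps to $(y)-(x)$), every class in $\operatorname{Pic}^0(G)$ is $[\partial c]$ for some integral $1$-chain $c$, and $\Psi : \operatorname{Pic}^0(G) \to \operatorname{Pic}^0(G^\star)$, $[\partial c] \mapsto [\partial c^\star]$, is a well-defined isomorphism. Genus $g = |E|-|V|+1$. For a spanning tree $T$ with non-tree edges $e_1,\dots,e_g$, a $T$-break divisor is $\sum_i(v_i)$ with $v_i$ an endpoint of $e_i$; $B(G)$ is the set of all such. Every class of $\operatorname{Pic}^g(G)$ contains a unique element of $B(G)$; $\gamma \cdot D :=$ the break divisor linearly equivalent to $D+\gamma$. Bernardi map: for a vertex $v$, an edge $e$ at $v$, and a spanning tree $T$, the tour starts at $v$ examining edges at $v$ in cyclic order starting with $e$; at current vertex $u$, an examined edge $f\notin T$ is cut through from $u$ and the next edge at $u$ examined, while $f \in T$ is walked along to its other endpoint $u'$, then edges at $u'$ are examined starting with the one after $f$; the tour ends when each tree edge is traversed in both directions. $\eta_{(v,e)}(f)$ is the endpoint from which $f\notin T$ is first cut through, and $\beta_{(v,e)}(T)=\sum_{f\notin T}(\eta_{(v,e)}(f))$, a bijection $S(G)\to B(G)$. The action $\beta_v$ is $\gamma\cdot T := \beta_{(v,e)}^{ -1}(\gamma\cdot\beta_{(v,e)}(T))$; for planar ribbon graphs it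 is independent of $v$ and $e$, and this common action is $\beta$ (similarly $\beta^\star$ for $G^\star$). -}

module Defs where

open import Algebra.Properties.CommutativeMonoid.Sum using (sum)
open import Data.Bool.Base using (Bool; true; false; not; if_then_else_)
open import Data.Fin.Base using (Fin)
import Data.Fin.Properties as Fin
open import Data.Fin.Subset using (Subset; _∈_; _-_; ∁; ⊤)
open import Data.Integer.Base as ℤ using (ℤ; 0ℤ; 1ℤ)
import Data.Integer.Properties as ℤ
open import Data.List.Base using (List; []; _∷_; map; iterate; find)
open import Data.List.Relation.Unary.Unique.Propositional using (Unique)
open import Data.Maybe.Base using (Maybe; maybe′)
open import Data.Nat.Base as ℕ using (ℕ)
open import Data.Nat.GeneralisedArithmetic using (fold)
open import Data.Product.Base using (Σ; ∃; _×_; _,_; proj₁; proj₂)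
open import Data.Vec.Base using (lookup)
open import Function.Base using (_∘_)
open import Function.Bundles using (_⇔_)
open import Relation.Binary.PropositionalEquality using (_≡_; _≢_)
open import Relation.Nullary.Decidable using (does)
open import Relation.Nullary.Negation using (¬_)

infix 5 ∑
∑ : ∀ {n} → (Fin n → ℤ) → ℤ
∑ = sum ℤ.+-0-commutativeMonoid
syntax ∑ (λ i → t) = ∑[ i ] t

------------------------------------------------------------------------
-- Ribbon graphs

-- A dart is a directed edge: each edge e carries the reference direction
-- (e , true) and its reverse (e , false).
DartOf : ℕ → Set
DartOf m = Fin m × Bool

edge : ∀ {m} → DartOf m → Fin m
edge = proj₁

flip : ∀ {m} → DartOf m → DartOf m
flip (e , b) = e , not b

-- `rot d` is the dart following d in the cyclic order at `source d`.
-- By `rot-orbits` (and finiteness) rot is a permutation of the darts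
-- whose cycles are exactly the nonempty fibres of `source`.
--
-- Connectedness and absence of loops are separate predicates below, so
-- that the planar dual can be formed before they are proved for it.
record RibbonGraph : Set where
  field
    nV nE      : ℕ
    source     : DartOf nE → Fin nV
    rot        : DartOf nE → DartOf nE
    rot-orbits : ∀ d d′ → source d ≡ source d′ ⇔ ∃ λ k → fold d rot k ≡ d′

  Vertex Edge Dart : Set
  Vertex = Fin nV
  Edge   = Fin nE
  Dart   = DartOf nE

  target : Dart → Vertex
  target d = source (flip d)

module _ (G : RibbonGraph) where
  open RibbonGraph G

  Loopless : Set
  Loopless = ∀ d → source d ≢ target d

  data Walk (A : Subset nE) : Vertex → Vertex → Set where
    []   : ∀ {u} → Walk A u u
    step : ∀ {w} d → edge d ∈ A → Walk A (target d) w → Walk A (source d) w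

  darts : ∀ {A u w} → Walk A u w → List Dart
  darts []           = []
  darts (step d _ p) = d ∷ darts p

  ConnectedVia : Subset nE → Set
  ConnectedVia A = ∀ u w → Walk A u w

  Connected : Set
  Connected = ConnectedVia ⊤

  -- Distinct edges are needed besides distinct vertices: otherwise
  -- going along an edge and straight back would be a cycle.
  IsCycle : ∀ {A u} → Walk A u u → Set
  IsCycle p = darts p ≢ [] × Unique (map source (darts p)) × Unique (map edge (darts p))

  Acyclic : Subset nE → Set
  Acyclic A = ∀ {u} (p : Walk A u u) → ¬ IsCycle p

  SpanningTree : Subset nE → Set
  SpanningTree T = ConnectedVia T × Acyclic T

  Bridge : Edge → Set
  Bridge e = ¬ ConnectedVia (⊤ - e)

  Bridgeless : Set
  Bridgeless = ∀ e → ¬ Bridge e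

------------------------------------------------------------------------
-- Planarity and the planar dual

-- With rot counterclockwise, the face to the left of d is also to the
-- right of rot d, i.e. to the left of flip (rot d), and iterating
-- flip ∘ rot runs clockwise around that face.  Faces are thus the orbits
-- of flip ∘ rot; they are given here by a labelling `left`.  A connected
-- ribbon graph embeds in the plane (equivalently, the sphere), with its
-- cyclic orders the counterclockwise ones, iff the closed oriented
-- surface obtained by gluing a disc along each face has Euler
-- characteristic 2.
-- `face-nonempty` excludes spurious faces; its first argument makes room
-- for the edgeless graph, whose only face has no dart on its boundary.
record Planar (G : RibbonGraph) : Set where
  open RibbonGraph G
  field
    nF            : ℕ
    left          : Dart → Fin nF
    left-orbits   : ∀ d d′ → left d ≡ left d′ ⇔ ∃ λ k → fold d (flip ∘ rot) k ≡ d′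
    face-nonempty : Dart → ∀ F → ∃ λ d → left d ≡ F
    euler         : nV ℕ.+ nF ≡ nE ℕ.+ 2

-- The dart d of the dual is the dual edge directed from the left of the
-- dart d of G to its right, so that turning from the dual dart to d is a
-- counterclockwise quarter turn.  The cyclic order at a face is clockwise.
dual : (G : RibbonGraph) → Planar G → RibbonGraph
dual G P = record
  { nV         = nF
  ; nE         = nE
  ; source     = left
  ; rot        = flip ∘ rot
  ; rot-orbits = left-orbits
  }
  where
  open RibbonGraph G
  open Planar P

-- T ↦ the duals of the edges not in T.
σ : (G : RibbonGraph) (P : Planar G) →
    Subset (RibbonGraph.nE G) → Subset (RibbonGraph.nE (dual G P))
σ G P = ∁

------------------------------------------------------------------------
-- Divisors and chains

module _ (G : RibbonGraph) where
  open RibbonGraph G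

  Divisor : Set
  Divisor = Vertex → ℤ

  ⟨_⟩ : Vertex → Divisor
  ⟨ v ⟩ u = if does (v Fin.≟ u) then 1ℤ else 0ℤ

  deg : Divisor → ℤ
  deg D = ∑[ u ] D u

  _⊕_ : Divisor → Divisor → Divisor
  (D ⊕ D′) u = D u ℤ.+ D′ u

  -- Each edge uw contributes f(u) − f(w) at u and f(w) − f(u) at w.
  Δ : (Vertex → ℤ) → Divisor
  Δ f u = ∑[ e ] (at (e , true) ℤ.+ at (e , false))
    where
    at : Dart → ℤ
    at d = ⟨ source d ⟩ u ℤ.* (f (source d) ℤ.- f (target d))

  LinEquiv : Divisor → Divisor → Set
  LinEquiv D D′ = ∃ λ f → ∀ u → D u ℤ.- D′ u ≡ Δ f u

  -- Representatives of the elements of Pic⁰, whose equality is LinEquiv.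
  Pic⁰ : Set
  Pic⁰ = Σ Divisor λ D → deg D ≡ 0ℤ

  -- c e is the coefficient of the reference direction of e; the reverse
  -- direction counts as its negative.
  Chain : Set
  Chain = Edge → ℤ

  ∂ : Chain → Divisor
  ∂ c u = ∑[ e ] c e ℤ.* (⟨ target (e , true) ⟩ u ℤ.- ⟨ source (e , true) ⟩ u)

-- Darts of G and of its dual are identified, with their reference
-- directions, so the coefficients do not change.
star : (G : RibbonGraph) (P : Planar G) → Chain G → Chain (dual G P)
star G P c = c

-- The graph of Ψ, i.e. Ψ[γ] = [γ⋆].
Ψ : (G : RibbonGraph) (P : Planar G) → Pic⁰ G → Pic⁰ (dual G P) → Set
Ψ G P (γ , _) (γ⋆ , _) =
  ∃ λ c → LinEquiv G γ (∂ G c) × LinEquiv (dual G P) γ⋆ (∂ (dual G P) (star G P c))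

------------------------------------------------------------------------
-- Break divisors and the Bernardi action

module _ (G : RibbonGraph) where
  open RibbonGraph G

  sumOutside : Subset nE → (Edge → Divisor G) → Divisor G
  sumOutside T D u = ∑[ e ] (if lookup T e then 0ℤ else D e u)

  -- b chooses an endpoint of each edge.
  IsBreak : Divisor G → Set
  IsBreak D = Σ (Subset nE) λ T → SpanningTree G T ×
    Σ (Edge → Bool) λ b → ∀ u → D u ≡ sumOutside T (λ e → ⟨_⟩ G (source (e , b e))) u

  -- D′ = γ · D.
  Translate : Pic⁰ G → Divisor G → Divisor G → Set
  Translate (γ , _) D D′ = IsBreak D′ × LinEquiv G D′ (_⊕_ G D γ)

  -- The dart examined after d: walk along a tree edge, cut through the others.
  next : Subset nE → Dart → Dart
  next T d = if lookup T (edge d) then rot (flip d) else rot d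

  -- The darts in the order of examination.  For a spanning tree T, `next`
  -- is a cyclic permutation of all 2|E| darts, so this is one full round.
  -- Whatever is examined after the last tree edge has been traversed in
  -- both directions lies at the initial vertex and has already been cut
  -- through from its other end (there are no loops), so it does not
  -- influence the first cuts.
  tour : Subset nE → Dart → List Dart
  tour T start = iterate (next T) start (2 ℕ.* nE)

  firstExamined : Subset nE → Dart → Edge → Maybe Dart
  firstExamined T start f = find (λ d → edge d Fin.≟ f) (tour T start)

  -- β_(v,e), where (v,e) is given by the dart `start` along e out of v.
  -- The default 0 is never used when T is a spanning tree.
  bernardi : Dart → Subset nE → Divisor G
  bernardi start T =
    sumOutside T λ f u → maybe′ (λ d → ⟨_⟩ G (source d) u) 0ℤ (firstExamined T start f)

  -- β is the action obtained by transporting the translation of break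
  -- divisors along `bernardi start`.  Since the latter is a bijection from
  -- spanning trees to break divisors, this determines β on spanning trees
  -- (its values elsewhere are irrelevant), and β respects LinEquiv.
  record IsBernardiAction (start : Dart)
                          (β : Pic⁰ G → Subset nE → Subset nE) : Set where
    field
      preserves  : ∀ γ {T} → SpanningTree G T → SpanningTree G (β γ T)
      translates : ∀ γ {T} → SpanningTree G T →
                   Translate γ (bernardi start T) (bernardi start (β γ T))

{-# OPTIONS --safe #-}
module Submission where

-- The tour of a tree T of G and the tour of ∁ T in the dual examine the same
-- edges in the same order.  Direct the edges of T towards the start and every
-- other edge away from the end where it is first cut through: G and its dual
-- get the same orientation.  The Bernardi divisor is the divisor of the initial
-- vertices of this orientation, up to a term that depends on the start only, so
-- for two trees the difference of the Bernardi divisors is ∂ c in G and ∂ c⋆ in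
-- the dual, for one chain c.  Since the cycles of a plane graph are the
-- coboundaries of its dual, [∂ c] = γ forces [∂ c⋆] = γ⋆.  It then remains to see,
-- in the dual, that the class of such a difference does not depend on the start,
-- and that the class of the Bernardi divisor determines the tree.

open import Defs
import Algebra.Properties.CommutativeMonoid.Sum as CommutativeMonoidSum
import Algebra.Properties.Semiring.Sum as SemiringSum
open import Data.Bool.Base using (Bool; true; false; not; if_then_else_)
import Data.Bool.Properties as Bool
open import Data.Fin.Base using (Fin; zero; suc; toℕ; combine; punchIn; punchOut)
import Data.Fin.Properties as Fin
open import Data.Fin.Subset using (Subset; _∈_; ∁; ∣_∣) renaming (_-_ to infixl 5 _∖_)
open import Data.Fin.Subset.Properties using (p─⊥≡p; x∈p⇒∣p-x∣<∣p∣; ∣∁p∣≡n∸∣p∣; ∣p∣≤n)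
open import Data.Integer.Base as ℤ using (ℤ; 0ℤ; 1ℤ; _+_; _-_; _*_; -_; _≤_; _<_)
import Data.Integer.Properties as ℤ
open import Data.Integer.Tactic.RingSolver using (solve-∀)
open import Data.List.Base using ([]; _∷_; map; find; iterate)
open import Data.List.Relation.Unary.All as All using (All; []; _∷_)
import Data.List.Relation.Unary.All.Properties as All
open import Data.List.Relation.Unary.AllPairs using ([]; _∷_)
open import Data.List.Relation.Unary.Unique.Propositional using (Unique)
open import Data.Maybe.Base using (just; maybe′)
open import Data.Nat.Base as ℕ using (ℕ; zero; suc; s≤s)
open import Data.Nat.GeneralisedArithmetic using (fold)
import Data.Nat.Properties as ℕ
open import Data.Product.Base using (∃; _×_; _,_; proj₁; proj₂)
import Data.Product.Properties as Product
open import Data.Sum.Base using (_⊎_; inj₁; inj₂; [_,_]′)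
open import Data.Unit.Base using (⊤; tt)
open import Data.Vec.Base using (_∷_; []; lookup)
open import Data.Vec.Properties
  using ([]=⇒lookup; lookup⇒[]=; lookup-map; tabulate∘lookup; tabulate-cong)
open import Function.Base using (_∘_)
open import Function.Bundles using (Equivalence; mk⇔)
open import Level using (0ℓ)
open import Relation.Binary.Core using (Rel)
open import Relation.Binary.Definitions using (DecidableEquality)
open import Relation.Binary.PropositionalEquality hiding ([_])
open import Relation.Binary.Structures using (IsEquivalence)
open import Relation.Nullary.Decidable using (Dec; yes; no; does; dec-true; dec-false; _⊎-dec_)
open import Relation.Nullary.Negation using (¬_; contradiction)

-- Duality exchanges the edges inside and outside a tree, so only an orientation of all edges can be
-- the same on both sides; this is why the tree edges are directed as well. Independence of the
-- start rests on two moves. Replacing the start `d` by `rot (flip d)` changes no Bernardi divisor,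
-- whatever the tree, so the divisor depends only on the face to the right of the start. Replacing
-- `d` by `rot d` changes its class by `target d` minus `source d`, again whatever the tree. Every
-- step of a tour is one of these moves, so two trees can be carried along the tour of either one.
-- That the class determines the tree is a maximum principle: in both orientations every vertex can
-- be reached from the start against the directions, so a potential whose gradient has the boundary
-- of their difference must be constant.

true≢false : true ≢ false
true≢false ()

same-edge : ∀ {m} (d x : DartOf m) → edge x ≡ edge d → x ≡ d ⊎ x ≡ flip d
same-edge (e , false) (e , false) refl = inj₁ refl
same-edge (e , false) (e , true)  refl = inj₂ refl
same-edge (e , true)  (e , false) refl = inj₂ refl
same-edge (e , true)  (e , true)  refl = inj₁ refl

flip-flip : ∀ {m} (d : DartOf m) → flip (flip d) ≡ d
flip-flip (e , b) = cong (e ,_) (Bool.not-involutive b)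

d≢flipd : ∀ {m} (d : DartOf m) → d ≢ flip d
d≢flipd (e , false) ()
d≢flipd (e , true)  ()

-- Components of a finite graph

module _ {m} {a b : Fin (suc m)} (a≢b : a ≢ b) where

  -- The index `a` is deleted and its point sent where `b` goes. The codomain is exactly one
  -- smaller, so `bound` in `Quotient` can count edges.
  merge : Fin (suc m) → Fin m
  merge x with x Fin.≟ a
  ... | yes _   = punchOut a≢b
  ... | no  x≢a = punchOut (x≢a ∘ sym)

  merge-surjective : ∀ y → ∃ λ x → merge x ≡ y
  merge-surjective y = punchIn a y , eq
    where
    eq : merge (punchIn a y) ≡ y
    eq with punchIn a y Fin.≟ a
    ... | yes p = contradiction p (Fin.punchInᵢ≢i a y)
    ... | no  _ = trans (Fin.punchOut-cong a refl) (Fin.punchOut-punchIn a)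

  merge-identifies : merge a ≡ merge b
  merge-identifies with a Fin.≟ a | b Fin.≟ a
  ... | no a≢a | _       = contradiction refl a≢a
  ... | yes _  | yes b≡a = contradiction (sym b≡a) a≢b
  ... | yes _  | no  _   = Fin.punchOut-cong a refl

  merge-injective : ∀ {x y} → merge x ≡ merge y →
                    x ≡ y ⊎ (x ≡ a × y ≡ b) ⊎ (x ≡ b × y ≡ a)
  merge-injective {x} {y} eq with x Fin.≟ a | y Fin.≟ a
  ... | yes p | yes q = inj₁ (trans p (sym q))
  ... | yes p | no  q = inj₂ (inj₁ (p , sym (Fin.punchOut-injective a≢b (q ∘ sym) eq)))
  ... | no  p | yes q = inj₂ (inj₂ (Fin.punchOut-injective (p ∘ sym) a≢b eq , q))
  ... | no  p | no  q = inj₁ (Fin.punchOut-injective (p ∘ sym) (q ∘ sym) eq)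

-- The components of the graph with edge set `T`. `generated` makes them the finest possible; taking
-- joinability by walks for `R` turns equal classes into walks. `bound` holds because an edge merges
-- at most two classes.
record Quotient {n k} (T : Subset k) (s t : Fin k → Fin n) : Set₁ where
  field
    size             : ℕ
    class            : Fin n → Fin size
    class-surjective : ∀ y → ∃ λ x → class x ≡ y
    bound            : n ℕ.≤ size ℕ.+ ∣ T ∣
    identifies       : ∀ e → lookup T e ≡ true → class (s e) ≡ class (t e)
    generated        : ∀ {R : Rel (Fin n) 0ℓ} → IsEquivalence R →
                       (∀ e → lookup T e ≡ true → R (s e) (t e)) →
                       ∀ {u w} → class u ≡ class w → R u w

quotient : ∀ {n k} (T : Subset k) (s t : Fin k → Fin n) → Quotient T s t
quotient {n} [] s t = record
  { size             = n
  ; class            = λ u → u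
  ; class-surjective = λ y → y , refl
  ; bound            = ℕ.m≤m+n n 0
  ; identifies       = λ ()
  ; generated        = λ eqv _ → IsEquivalence.reflexive eqv
  }
quotient (false ∷ T) s t = record
  { size             = size
  ; class            = class
  ; class-surjective = class-surjective
  ; bound            = bound
  ; identifies       = λ { (suc e) → identifies e }
  ; generated        = λ eqv r → generated eqv (r ∘ suc)
  }
  where open Quotient (quotient T (s ∘ suc) (t ∘ suc))
quotient {n} (true ∷ T) s t = glue (quotient T (s ∘ suc) (t ∘ suc))
  where
  glue : Quotient T (s ∘ suc) (t ∘ suc) → Quotient (true ∷ T) s t
  glue record { size = zero ; class = c } with () ← c (s zero)
  glue record { size = suc k ; class = c ; class-surjective = surj ; bound = bd
              ; identifies = ident ; generated = gen } with c (s zero) Fin.≟ c (t zero)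
  ... | yes p = record
    { size             = suc k
    ; class            = c
    ; class-surjective = surj
    ; bound            = ℕ.≤-trans bd (ℕ.+-monoʳ-≤ (suc k) (ℕ.n≤1+n _))
    ; identifies       = λ { zero _ → p ; (suc e) → ident e }
    ; generated        = λ eqv r → gen eqv (r ∘ suc)
    }
  ... | no a≢b = record
    { size             = k
    ; class            = merge a≢b ∘ c
    ; class-surjective = λ y → let z , z↦y = merge-surjective a≢b y
                                   x , x↦z = surj z
                               in x , trans (cong (merge a≢b) x↦z) z↦y
    ; bound            = subst (n ℕ.≤_) (sym (ℕ.+-suc k ∣ T ∣)) bd
    ; identifies       = λ { zero _ → merge-identifies a≢b
                           ; (suc e) q → cong (merge a≢b) (ident e q) }
    ; generated        = λ {R} eqv r q →
        let open IsEquivalence eqv using () renaming (sym to R-sym; trans to R-trans)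
            old : ∀ {u w} → c u ≡ c w → R u w
            old = gen eqv (r ∘ suc)
            new : R (s zero) (t zero)
            new = r zero refl
        in [ old
           , [ (λ (p , q) → R-trans (old p) (R-trans new (old (sym q))))
             , (λ (p , q) → R-trans (old p) (R-trans (R-sym new) (old (sym q)))) ]′ ]′
           (merge-injective a≢b q)
    }

module _ {n m} (src : DartOf m → Fin n) (T : Subset m) where

  quotientᵈ : Quotient T (λ e → src (e , true)) (λ e → src (e , false))
  quotientᵈ = quotient T _ _

  identifiesᵈ : ∀ d → lookup T (edge d) ≡ true →
                Quotient.class quotientᵈ (src d) ≡ Quotient.class quotientᵈ (src (flip d))
  identifiesᵈ (e , true)  e∈T = Quotient.identifies quotientᵈ e e∈T
  identifiesᵈ (e , false) e∈T = sym (Quotient.identifies quotientᵈ e e∈T)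

-- Trees

record Cut {n m} (src : DartOf m → Fin n) (T : Subset m) (d : DartOf m) : Set where
  field
    side   : Fin n → Bool
    behind : side (src d) ≡ false
    ahead  : side (src (flip d)) ≡ true
    uncut  : ∀ x → lookup T (edge x) ≡ true → edge x ≢ edge d →
             side (src x) ≡ side (src (flip x))

-- Connectedness is an induction principle and acyclicity a supply of cuts: the tour arguments use
-- just these, and for the dual they can be produced without walks or cycles.
record Tree {n m} (src : DartOf m → Fin n) (T : Subset m) : Set₁ where
  field
    induction : ∀ (P : Fin n → Set) →
                (∀ d → lookup T (edge d) ≡ true → P (src d) → P (src (flip d))) →
                ∀ {u w} → P u → P w
    cut       : ∀ d → lookup T (edge d) ≡ true → Cut src T d

lookup-without : ∀ {m} (T : Subset m) {e f} → f ≢ e → lookup (T ∖ e) f ≡ lookup T f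
lookup-without (_ ∷ T) {zero}  {zero}  f≢e = contradiction refl f≢e
lookup-without (_ ∷ T) {zero}  {suc f} f≢e = cong (λ U → lookup U f) (p─⊥≡p T)
lookup-without (_ ∷ T) {suc e} {zero}  f≢e = refl
lookup-without (_ ∷ T) {suc e} {suc f} f≢e = lookup-without T (f≢e ∘ cong suc)

lookup-removed : ∀ {m} (T : Subset m) e → lookup (T ∖ e) e ≡ false
lookup-removed (_ ∷ T) zero    = refl
lookup-removed (_ ∷ T) (suc e) = lookup-removed T e

kept : ∀ {m} (T : Subset m) {e f} → lookup (T ∖ e) f ≡ true → f ≢ e × lookup T f ≡ true
kept T {e} {f} f∈ = f≢e , trans (sym (lookup-without T f≢e)) f∈
  where
  f≢e : f ≢ e
  f≢e refl with () ← trans (sym f∈) (lookup-removed T e)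

-- Walks, loop erasure and the cuts of a spanning tree

module _ (G : RibbonGraph) where
  open RibbonGraph G

  private variable
    A B : Subset nE
    u v w : Vertex

  _++_ : Walk G A u v → Walk G A v w → Walk G A u w
  []         ++ q = q
  step d m p ++ q = step d m (p ++ q)

  along : ∀ d → edge d ∈ A → Walk G A (source d) (target d)
  along d m = step d m []

  reverse : Walk G A u w → Walk G A w u
  reverse []                   = []
  reverse (step d@(e , b) m p) =
    reverse p ++ subst (Walk G _ (target d) ∘ source) (flip-flip d) (along (flip d) m)

  walk-isEquivalence : IsEquivalence (Walk G A)
  walk-isEquivalence = record { refl = [] ; sym = reverse ; trans = _++_ }

  weaken : (∀ {e} → e ∈ A → e ∈ B) → (p : Walk G A u w) →
           ∃ λ (q : Walk G B u w) → darts G q ≡ darts G p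
  weaken A⊆B []           = [] , refl
  weaken A⊆B (step d m p) =
    let q , eq = weaken A⊆B p in step d (A⊆B m) q , cong (d ∷_) eq

  _∈ᵥ_ : Vertex → Walk G A u w → Set
  x ∈ᵥ ([] {u = u})  = x ≡ u
  x ∈ᵥ step d _ p    = x ≡ source d ⊎ x ∈ᵥ p

  _∈ᵥ?_ : ∀ x (p : Walk G A u w) → Dec (x ∈ᵥ p)
  x ∈ᵥ? ([] {u = u})  = x Fin.≟ u
  x ∈ᵥ? step d _ p    = x Fin.≟ source d ⊎-dec x ∈ᵥ? p

  Simple : Walk G A u w → Set
  Simple []           = ⊤
  Simple (step d _ p) = ¬ (source d ∈ᵥ p) × Simple p

  suffix : ∀ {x} (p : Walk G A u w) → Simple p → x ∈ᵥ p → ∃ λ (q : Walk G A x w) → Simple q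
  suffix []             s       refl        = [] , s
  suffix p@(step _ _ _) s       (inj₁ refl) = p , s
  suffix (step _ _ p)   (_ , s) (inj₂ x∈p)  = suffix p s x∈p

  erase-loops : Walk G A u w → ∃ λ (q : Walk G A u w) → Simple q
  erase-loops []           = [] , tt
  erase-loops (step d m p) with q , s ← erase-loops p with source d ∈ᵥ? q
  ... | yes d∈q = suffix q s d∈q
  ... | no  d∉q = step d m q , d∉q , s

  first∈ᵥ : (p : Walk G A u w) → u ∈ᵥ p
  first∈ᵥ []           = refl
  first∈ᵥ (step _ _ _) = inj₁ refl

  last∈ᵥ : (p : Walk G A u w) → w ∈ᵥ p
  last∈ᵥ []           = refl
  last∈ᵥ (step _ _ p) = inj₂ (last∈ᵥ p)

  ends∈ᵥ : (p : Walk G A u w) → All (λ x → source x ∈ᵥ p × target x ∈ᵥ p) (darts G p)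
  ends∈ᵥ []           = []
  ends∈ᵥ (step d _ p) =
    (inj₁ refl , inj₂ (first∈ᵥ p)) ∷ All.map (λ (s , t) → inj₂ s , inj₂ t) (ends∈ᵥ p)

  edges∈ : (p : Walk G A u w) → All (λ x → edge x ∈ A) (darts G p)
  edges∈ []           = []
  edges∈ (step _ m p) = m ∷ edges∈ p

  simple⇒source≢last : (p : Walk G A u w) → Simple p → All (λ x → source x ≢ w) (darts G p)
  simple⇒source≢last []           _         = []
  simple⇒source≢last (step d _ p) (d∉p , s) =
    (λ { refl → d∉p (last∈ᵥ p) }) ∷ simple⇒source≢last p s

  simple⇒unique : (p : Walk G A u w) → Simple p →
                  Unique (map source (darts G p)) × Unique (map edge (darts G p))
  simple⇒unique []           _         = [] , []
  simple⇒unique (step d _ p) (d∉p , s) =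
    let us , ue = simple⇒unique p s in
    All.map⁺ (All.map (λ (x∈p , _) eq → d∉p (subst (_∈ᵥ p) (sym eq) x∈p)) (ends∈ᵥ p)) ∷ us ,
    All.map⁺ (All.map (λ { {x} x∈ eq → [ (λ { refl → d∉p (proj₁ x∈) })
                                       , (λ { refl → d∉p (subst ((_∈ᵥ p) ∘ source) (flip-flip d) (proj₂ x∈)) }) ]′
                                       (same-edge d x (sym eq)) }) (ends∈ᵥ p)) ∷ ue

  -- After loop erasure no vertex repeats, hence no edge either, since both darts of an edge start
  -- at its ends. The edge of `d` is absent from the walk, so putting `d` in front closes a cycle.
  closing-edge : ∀ {T} d → edge d ∈ T → Walk G (T ∖ edge d) (target d) (source d) → ¬ Acyclic G T
  closing-edge {T} d d∈T p₀ acyclic with p , s ← erase-loops p₀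
    with q , eq ← weaken {B = T} (λ {f} f∈ → lookup⇒[]= f T (proj₂ (kept T ([]=⇒lookup f∈)))) p
    = acyclic (step d d∈T q)
        ( (λ ())
        , subst (λ ds → Unique (map source (d ∷ ds))) (sym eq)
            (All.map⁺ (All.map (_∘ sym) (simple⇒source≢last p s)) ∷ proj₁ (simple⇒unique p s))
        , subst (λ ds → Unique (map edge (d ∷ ds))) (sym eq)
            (All.map⁺ (All.map (λ f∈ eq → proj₁ (kept T ([]=⇒lookup f∈)) (sym eq)) (edges∈ p))
              ∷ proj₂ (simple⇒unique p s)))

  walk-induction : ∀ {T} (P : Vertex → Set) →
                   (∀ d → lookup T (edge d) ≡ true → P (source d) → P (target d)) →
                   Walk G T u w → P u → P w
  walk-induction P h []           pu = pu
  walk-induction P h (step d m p) pu = walk-induction P h p (h d ([]=⇒lookup m) pu)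

  spanningTree⇒tree : ∀ {T} → SpanningTree G T → Tree source T
  spanningTree⇒tree {T} (connected , acyclic) = record
    { induction = λ P h {u} {w} → walk-induction P h (connected u w)
    ; cut       = cut
    }
    where
    cut : ∀ d → lookup T (edge d) ≡ true → Cut source T d
    cut d d∈T = record
      { side   = λ u → does (class u Fin.≟ class (target d))
      ; behind = dec-false (class (source d) Fin.≟ _) λ eq →
          closing-edge d (lookup⇒[]= _ T d∈T) (reverse (joined eq)) acyclic
      ; ahead  = dec-true (class (target d) Fin.≟ _) refl
      ; uncut  = λ x x∈T x≢d → cong (λ c → does (c Fin.≟ class (target d)))
          (identifiesᵈ source (T ∖ edge d) x (trans (lookup-without T x≢d) x∈T))
      }
      where
      open Quotient (quotientᵈ source (T ∖ edge d))
      joined : ∀ {u w} → class u ≡ class w → Walk G (T ∖ edge d) u w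
      joined = generated walk-isEquivalence λ e e∈ → along (e , true) (lookup⇒[]= e _ e∈)

  constant-side : ∀ {T d} (C : Cut source T d) (p : Walk G T u w) →
                  All (λ x → edge d ≢ edge x) (darts G p) → Cut.side C u ≡ Cut.side C w
  constant-side C []           []            = refl
  constant-side C (step x m p) (d≢x ∷ d≢p) =
    trans (Cut.uncut C x ([]=⇒lookup m) (d≢x ∘ sym)) (constant-side C p d≢p)

  -- Beyond its first dart `d` a cycle avoids the edge of `d`, so it would stay ahead of the cut of
  -- `d` and yet end behind it.
  tree⇒spanningTree : ∀ {T} → Tree source T → SpanningTree G T
  tree⇒spanningTree {T} tree = connected , acyclic
    where
    open Tree tree
    connected : ConnectedVia G T
    connected u w = induction (Walk G T u) (λ d d∈T p → p ++ along d (lookup⇒[]= _ T d∈T)) []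
    acyclic : Acyclic G T
    acyclic []           (nonempty , _)     = nonempty refl
    acyclic (step d m p) (_ , _ , d∉p ∷ _) =
      true≢false (trans (sym ahead) (trans (constant-side C p (All.map⁻ d∉p)) behind))
      where
      C = cut d ([]=⇒lookup m)
      open Cut C

dart-code : ∀ {m} → DartOf m → Fin (2 ℕ.* m)
dart-code (e , false) = combine {2} zero e
dart-code (e , true)  = combine {2} (suc zero) e

dart-code-injective : ∀ {m} {d x : DartOf m} → dart-code d ≡ dart-code x → d ≡ x
dart-code-injective {d = e , false} {f , false} eq =
  cong (_, false) (Fin.combine-injectiveʳ {2} zero e zero f eq)
dart-code-injective {d = e , true}  {f , true}  eq =
  cong (_, true) (Fin.combine-injectiveʳ {2} (suc zero) e (suc zero) f eq)
dart-code-injective {d = e , false} {f , true}  eq with () ← Fin.combine-injectiveˡ {2} zero e (suc zero) f eq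
dart-code-injective {d = e , true}  {f , false} eq with () ← Fin.combine-injectiveˡ {2} (suc zero) e zero f eq

-- The times from 0 to `2 * m` outnumber the darts by one. The bound on the later time is what
-- `length-bound` compares with the length of the list `tour`.
dart-pigeonhole : ∀ {m} (t : ℕ → DartOf m) → ∃ λ i → ∃ λ k → i ℕ.+ suc k ℕ.≤ 2 ℕ.* m × t i ≡ t (i ℕ.+ suc k)
dart-pigeonhole {m} t
  with i , j , i<j , eq ← Fin.pigeonhole ℕ.≤-refl (λ (i : Fin (suc (2 ℕ.* m))) → dart-code (t (toℕ i)))
  = toℕ i , toℕ j ℕ.∸ suc (toℕ i) , subst (ℕ._≤ 2 ℕ.* m) (sym j≡) (ℕ.≤-pred (Fin.toℕ<n j))
  , trans (dart-code-injective eq) (cong t (sym j≡))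
  where
  j≡ : toℕ i ℕ.+ suc (toℕ j ℕ.∸ suc (toℕ i)) ≡ toℕ j
  j≡ = trans (ℕ.+-suc (toℕ i) _) (ℕ.m+[n∸m]≡n i<j)

module _ (G : RibbonGraph) where
  open RibbonGraph G

  source-rot : ∀ d → source (rot d) ≡ source d
  source-rot d = sym (Equivalence.from (rot-orbits d (rot d)) (1 , refl))

  rot⁻¹ : ∀ d → ∃ λ x → rot x ≡ d
  rot⁻¹ d =
    let k , eq = Equivalence.to (rot-orbits (rot d) d) (source-rot d)
    in fold d rot k , trans (slide k) eq
    where
    slide : ∀ k → rot (fold d rot k) ≡ fold (rot d) rot k
    slide zero    = refl
    slide (suc k) = cong rot (slide k)

-- The tour as iteration of `next`

module Walking (G : RibbonGraph) (T : Subset (RibbonGraph.nE G)) where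
  open RibbonGraph G

  infixr 5 _∷_

  -- The part of the tour from d up to, but excluding, x, with all its darts in Q.
  data Stretch (Q : Dart → Set) : Dart → Dart → Set where
    []  : ∀ {d} → Stretch Q d d
    _∷_ : ∀ {d x} → Q d → Stretch Q (next G T d) x → Stretch Q d x

  Reaches : Dart → Dart → Set
  Reaches = Stretch λ _ → ⊤

  -- (f , b) is the first dart along f that is examined from d on.
  data First : Dart → Edge → Bool → Set where
    here  : ∀ {f b} → First (f , b) f b
    there : ∀ {d f b} → edge d ≢ f → First (next G T d) f b → First d f b

  next-in : ∀ d → lookup T (edge d) ≡ true → next G T d ≡ rot (flip d)
  next-in d d∈T rewrite d∈T = refl

  next-out : ∀ d → lookup T (edge d) ≡ false → next G T d ≡ rot d
  next-out d d∉T rewrite d∉T = refl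

  source-next-in : ∀ d → lookup T (edge d) ≡ true → source (next G T d) ≡ target d
  source-next-in d d∈T = trans (cong source (next-in d d∈T)) (source-rot G (flip d))

  next-flip-in : ∀ d → lookup T (edge d) ≡ true → next G T (flip d) ≡ rot d
  next-flip-in d d∈T = trans (next-in (flip d) d∈T) (cong rot (flip-flip d))

  private variable
    P Q : Dart → Set
    c d x y : Dart
    f : Edge
    b b′ : Bool

  _++ˢ_ : Stretch Q c d → Stretch Q d x → Stretch Q c x
  []      ++ˢ s = s
  (q ∷ r) ++ˢ s = q ∷ (r ++ˢ s)

  mapˢ : (∀ {x} → P x → Q x) → Stretch P c d → Stretch Q c d
  mapˢ h []      = []
  mapˢ h (p ∷ s) = h p ∷ mapˢ h s

  _∷ʳ_ : Stretch Q c d → Q d → Stretch Q c (next G T d)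
  s ∷ʳ q = s ++ˢ (q ∷ [])

  -- Whenever the loop is used up it is restarted at `d`. Applied to the property of differing from
  -- a given dart, this refutes a loop that misses the dart.
  loop-covers : Q d → Stretch Q (next G T d) d → Reaches d x → Q x
  loop-covers {Q} {d} q loop = go (q ∷ loop)
    where
    go : ∀ {c x} → Stretch Q c d → Reaches c x → Q x
    go []      []      = q
    go (p ∷ _) []      = p
    go []      (_ ∷ r) = go loop r
    go (_ ∷ s) (_ ∷ r) = go s r

  first-unique : First d f b → First d f b′ → b ≡ b′
  first-unique here        here        = refl
  first-unique here        (there d≢f _) = contradiction refl d≢f
  first-unique (there d≢f _) here        = contradiction refl d≢f
  first-unique (there _ p) (there _ q) = first-unique p q

  first⇒stretch : First d f b → Stretch (λ x → edge x ≢ f) d (f , b)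
  first⇒stretch here        = []
  first⇒stretch (there d≢f p) = d≢f ∷ first⇒stretch p

  skip : Stretch (λ x → edge x ≢ f) d x → First x f b → First d f b
  skip []      p = p
  skip (d≢f ∷ s) p = there d≢f (skip s p)

  first-in-stretch : First d f b → Stretch Q d x → Q (f , b) ⊎ Stretch (λ x → edge x ≢ f) d x
  first-in-stretch p           []      = inj₂ []
  first-in-stretch here        (q ∷ s) = inj₁ q
  first-in-stretch (there d≢f p) (_ ∷ s) with first-in-stretch p s
  ... | inj₁ q = inj₁ q
  ... | inj₂ r = inj₂ (d≢f ∷ r)

  length : First d f b → ℕ
  length here        = 0
  length (there _ p) = suc (length p)

  length-unique : (p : First d f b) (q : First d f b′) → length p ≡ length q
  length-unique here        here        = refl
  length-unique here        (there d≢f _) = contradiction refl d≢f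
  length-unique (there d≢f _) here        = contradiction refl d≢f
  length-unique (there _ p) (there _ q) = cong suc (length-unique p q)

  drop : (p : First d f b) → ∀ j → j ℕ.≤ length p →
         ∃ λ (q : First (fold d (next G T) j) f b) → length q ℕ.+ j ≡ length p
  drop p zero    _  = p , ℕ.+-identityʳ _
  drop p (suc j) j< with drop p j (ℕ.<⇒≤ j<)
  ... | q , eq = tail q eq
    where
    tail : ∀ {x} (q : First x _ _) → length q ℕ.+ j ≡ length p →
           ∃ λ (r : First (next G T x) _ _) → length r ℕ.+ suc j ≡ length p
    tail here        eq = contradiction (sym eq) (ℕ.>⇒≢ j<)
    tail (there _ r) eq = r , trans (ℕ.+-suc (length r) j) eq

  -- A first visit at time 2|E| or later would come after two visits to the
  -- same dart, from which the first visit is at two different distances.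
  length-bound : (p : First d f b) → length p ℕ.< 2 ℕ.* nE
  length-bound {d} {f} {b} p with length p ℕ.<? 2 ℕ.* nE
  ... | yes p< = p<
  ... | no  p≮ with i , k , bound , eq ← dart-pigeonhole (fold d (next G T))
    = contradiction (drop p i (ℕ.≤-trans (ℕ.m≤m+n i (suc k)) j≤)) clash
    where
    j≤ : i ℕ.+ suc k ℕ.≤ length p
    j≤ = ℕ.≤-trans bound (ℕ.≮⇒≥ p≮)
    clash : ¬ ∃ λ (q : First (fold d (next G T) i) f b) → length q ℕ.+ i ≡ length p
    clash (q , q≡) with r , r≡ ← drop p (i ℕ.+ suc k) j≤ =
      ℕ.m≢1+m+n i (ℕ.+-cancelˡ-≡ (length q) _ _ (trans q≡ (trans (sym r≡)
        (cong₂ ℕ._+_ (length-unique′ r q (sym eq)) (ℕ.+-suc i k)))))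
      where
      length-unique′ : ∀ {x y} (p : First x f b) (q : First y f b) → x ≡ y → length p ≡ length q
      length-unique′ p q refl = length-unique p q

  find-first : (p : First d f b) → ∀ n → length p ℕ.< n →
               find (λ x → edge x Fin.≟ f) (iterate (next G T) d n) ≡ just (f , b)
  find-first {f = f} here (suc n) _ rewrite dec-true (f Fin.≟ f) refl = refl
  find-first {d} {f} (there d≢f p) (suc n) (s≤s p<n) rewrite dec-false (edge d Fin.≟ f) d≢f = find-first p n p<n

  firstExamined≡ : First d f b → firstExamined G T d f ≡ just (f , b)
  firstExamined≡ p = find-first p (2 ℕ.* nE) (length-bound p)

  next⁻¹ : ∀ d → ∃ λ x → next G T x ≡ d
  next⁻¹ d with x , eq ← rot⁻¹ G d with lookup T (edge x) in x?
  ... | true  = flip x , trans (next-flip-in x x?) eq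
  ... | false = x , trans (next-out x x?) eq

  abstract
    -- Only a right inverse of `next` is at hand. Its iterates from `d` repeat, which gives a return
    -- to some dart `back i`; applying `next` to the whole stretch `i` times carries this return to
    -- `d`.
    returns : ∀ d → Reaches (next G T d) d
    returns d with i , k , _ , eq ← dart-pigeonhole (fold d (λ x → proj₁ (next⁻¹ x)))
      = ascend i (subst (λ x → Reaches x (back i))
                        (trans (sym (proj₂ (next⁻¹ _)))
                               (cong (next G T) (trans (cong back (sym (ℕ.+-suc i k))) (sym eq))))
                        (forth k))
      where
      back : ℕ → Dart
      back = fold d (λ x → proj₁ (next⁻¹ x))
      push : ∀ {x y} → Reaches x y → Reaches (next G T x) (next G T y)
      push []      = []
      push (_ ∷ s) = tt ∷ push s
      ascend : ∀ i → Reaches (next G T (back i)) (back i) → Reaches (next G T d) d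
      ascend zero    r = r
      ascend (suc i) r = ascend i (subst (λ x → Reaches (next G T x) x) (proj₂ (next⁻¹ (back i))) (push r))
      forth : ∀ j → Reaches (back (i ℕ.+ j)) (back i)
      forth zero    = subst (λ n → Reaches (back n) (back i)) (sym (ℕ.+-identityʳ i)) []
      forth (suc j) = subst (λ n → Reaches (back n) (back i)) (sym (ℕ.+-suc i j))
        (tt ∷ subst (λ x → Reaches x (back i)) (sym (proj₂ (next⁻¹ _))) (forth j))

  reaches-sym : Reaches d x → Reaches x d
  reaches-sym []                = []
  reaches-sym (_∷_ {d = d} _ r) = reaches-sym r ++ˢ returns d

-- The tour of a tree

module Tour (G : RibbonGraph) {T : Subset (RibbonGraph.nE G)} (tree : Tree (RibbonGraph.source G) T) where
  open RibbonGraph G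
  open Tree tree
  open Walking G T public

  private variable
    d x y s : Dart
    f : Edge
    b : Bool

  module _ (C : Cut source T d) where
    open Cut C

    side-next : ∀ y → edge y ≢ edge d → side (source (next G T y)) ≡ side (source y)
    side-next y y≢d with lookup T (edge y) in y?
    ... | true  = trans (cong side (source-rot G (flip y))) (sym (uncut y y? y≢d))
    ... | false = cong side (source-rot G y)

    stretch-ahead : side (source y) ≡ true → Reaches y d → Stretch (λ x → side (source x) ≡ true) y (flip d)
    stretch-ahead y+ []      = contradiction (trans (sym y+) behind) true≢false
    stretch-ahead {y} y+ (_ ∷ r) with edge y Fin.≟ edge d
    ... | no  y≢d = y+ ∷ stretch-ahead (trans (side-next y y≢d) y+) r
    ... | yes y≡d with same-edge d y y≡d
    ...   | inj₁ refl = contradiction (trans (sym y+) behind) true≢false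
    ...   | inj₂ refl = []

    stretch-behind : side (source y) ≡ false → Reaches y d →
                     Stretch (λ x → side (source x) ≡ false × edge x ≢ edge d) y d
    stretch-behind y- []      = []
    stretch-behind {y} y- (_ ∷ r) with edge y Fin.≟ edge d
    ... | no  y≢d = (y- , y≢d) ∷ stretch-behind (trans (side-next y y≢d) y-) r
    ... | yes y≡d with same-edge d y y≡d
    ...   | inj₁ refl = []
    ...   | inj₂ refl = contradiction (trans (sym ahead) y-) true≢false

  -- Walking along `d` leads ahead of its cut, and the tour has to return to `d`, which starts
  -- behind. Only the edge of `d` crosses the cut, so the way back is `flip d`.
  reaches-flip : ∀ d → lookup T (edge d) ≡ true → Reaches d (flip d)
  reaches-flip d d∈T = tt ∷ mapˢ _
    (stretch-ahead C (trans (cong side (source-next-in d d∈T)) ahead) (returns d))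
    where
    C = cut d d∈T
    open Cut C

  reaches-rot : ∀ d → Reaches d (rot d)
  reaches-rot d with lookup T (edge d) in d?
  ... | false = tt ∷ subst (λ x → Reaches x (rot d)) (sym (next-out d d?)) []
  ... | true  = reaches-flip d d? ++ˢ (tt ∷ subst (λ x → Reaches x (rot d)) (sym (next-flip-in d d?)) [])

  -- An excursion along a tree edge ends by coming back and going on to the next dart at the vertex,
  -- so all darts at one vertex are reached; induction over the tree then gives all vertices.
  cyclic : ∀ d x → Reaches d x
  cyclic d x = induction (λ u → ∀ {x} → u ≡ source x → Reaches d x)
    (λ c c∈T reach → around (flip c) (reach refl ++ˢ reaches-flip c c∈T)) (around d []) refl
    where
    around : ∀ c → Reaches d c → ∀ {x} → source c ≡ source x → Reaches d x
    around c r {x} eq with k , c↦x ← Equivalence.to (rot-orbits c x) eq = subst (Reaches d) c↦x (go k)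
      where
      go : ∀ k → Reaches d (fold c rot k)
      go zero    = r
      go (suc k) = go k ++ˢ reaches-rot _

  abstract
    first : ∀ s f → ∃ λ b → First s f b
    first s f = go (cyclic s (f , true))
      where
      go : ∀ {c} → Reaches c (f , true) → ∃ λ b → First c f b
      go []                = true , here
      go (_∷_ {d = c} _ r) with edge c Fin.≟ f
      ... | yes refl = proj₂ c , here
      ... | no  c≢f  = let b , p = go r in b , there c≢f p

  orient : Dart → Edge → Bool
  orient s f = proj₁ (first s f)

  orient-≡ : First s f b → orient s f ≡ b
  orient-≡ p = first-unique (proj₂ (first _ _)) p

  orient-here : ∀ d → orient d (edge d) ≡ proj₂ d
  orient-here d = orient-≡ here

  orient-next : ∀ d → f ≢ edge d → orient (next G T d) f ≡ orient d f
  orient-next d f≢d = sym (orient-≡ (there (f≢d ∘ sym) (proj₂ (first _ _))))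

  -- If the same dart came first again, the tour would have closed up without examining its reverse,
  -- against `cyclic`.
  first-next-here : First (next G T d) (edge d) b → b ≡ not (proj₂ d)
  first-next-here {d = e , b′} {b} p with b Bool.≟ b′
  ... | no  b≢b′ = Bool.¬-not b≢b′
  ... | yes refl = contradiction refl
    (loop-covers {Q = _≢ flip (e , b)} (d≢flipd _)
      (mapˢ (λ e≢ eq → e≢ (cong edge eq)) (first⇒stretch p)) (cyclic _ _))

  orient-next-here : ∀ d → orient (next G T d) (edge d) ≡ not (proj₂ d)
  orient-next-here d = first-next-here (proj₂ (first (next G T d) (edge d)))

  -- The tour can change sides only along the edge of the cut, which is not examined before
  -- `(f , b)`; so the start is on the side of that dart's source.
  fresh : First s f b → (C : Cut source T (f , b)) → Cut.side C (source s) ≡ false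
  fresh here              C = Cut.behind C
  fresh (there {d} d≢f p) C = trans (sym (side-next C d d≢f)) (fresh p C)

  not-entering-start : First s f b → lookup T f ≡ true → target (f , b) ≢ source s
  not-entering-start p f∈T eq =
    true≢false (trans (sym (Cut.ahead C)) (trans (cong (Cut.side C) eq) (fresh p C)))
    where C = cut _ f∈T

  -- The earlier of the two traversals brings the tour to the common target; seen from there, a
  -- later first traversal cannot enter that vertex, by `not-entering-start`.
  entering-unique : ∀ {f′ b′} → First s f b → First s f′ b′ → lookup T f ≡ true → lookup T f′ ≡ true →
                    target (f , b) ≡ target (f′ , b′) → f ≡ f′
  entering-unique here        here        _   _    _  = refl
  entering-unique here        (there _ q) f∈T f′∈T eq =
    contradiction (trans (sym eq) (sym (source-next-in _ f∈T))) (not-entering-start q f′∈T)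
  entering-unique (there _ p) here        f∈T f′∈T eq =
    contradiction (trans eq (sym (source-next-in _ f′∈T))) (not-entering-start p f∈T)
  entering-unique (there _ p) (there _ q) f∈T f′∈T eq = entering-unique p q f∈T f′∈T eq

  entering : Reaches s y → source y ≢ source s →
             ∃ λ f → ∃ λ b → lookup T f ≡ true × First s f b × source y ≡ target (f , b)
  entering []                    y≢s = contradiction refl y≢s
  entering {y = y} (_∷_ {d = s} _ r) y≢s with source y Fin.≟ source (next G T s)
  ... | yes y≡ with lookup T (edge s) in s?
  ...   | true  = edge s , proj₂ s , s? , here , trans y≡ (source-rot G (flip s))
  ...   | false = contradiction (trans y≡ (source-rot G s)) y≢s
  entering {y = y} (_∷_ {d = s} _ r) y≢s | no y≢ with f , b , f∈T , p , y≡ ← entering r y≢ with edge s Fin.≟ f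
  ... | no  s≢f  = f , b , f∈T , there s≢f p , y≡
  -- After `s`, its edge is next taken backwards, which leads to `source s` and not to a new vertex.
  ... | yes refl with refl ← first-next-here p = contradiction (trans y≡ (cong source (flip-flip s))) y≢s

  -- The second traversal of a tree edge only returns to a vertex where `P` is already known, so
  -- first traversals suffice.
  exploration : (P : Vertex → Set) →
                (∀ {f b} → First s f b → lookup T f ≡ true → P (source (f , b)) → P (target (f , b))) →
                P (source s) → Reaches s y → P (source y)
  exploration P h ps []                = ps
  exploration P h ps (_∷_ {d = s} _ r) = exploration P h′ ps′ r
    where
    ps′ : P (source (next G T s))
    ps′ with lookup T (edge s) in s?
    ... | true  = subst P (sym (source-rot G (flip s))) (h here s? ps)
    ... | false = subst P (sym (source-rot G s)) ps
    h′ : ∀ {f b} → First (next G T s) f b → lookup T f ≡ true → P (source (f , b)) → P (target (f , b))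
    h′ {f} p f∈T pf with edge s Fin.≟ f
    ... | no  s≢f  = h (there s≢f p) f∈T pf
    ... | yes refl with refl ← first-next-here p = subst P (sym (cong source (flip-flip s))) ps

  -- Starting at rot d instead of d exchanges the two parts into which the
  -- removal of a tree edge d divides the tour.
  module Split (d : Dart) (d∈T : lookup T (edge d) ≡ true) (C : Cut source T d) where
    open Cut C

    Ahead Behind : Dart → Set
    Ahead  x = side (source x) ≡ true
    Behind x = side (source x) ≡ false × edge x ≢ edge d

    first-part : Stretch Ahead (next G T d) (rot d)
    first-part = subst (Stretch Ahead (next G T d)) (next-flip-in d d∈T)
      (stretch-ahead C (trans (cong side (source-next-in d d∈T)) ahead) (returns d) ∷ʳ ahead)

    second-part : Stretch Behind (rot d) d
    second-part = stretch-behind C (trans (cong side (source-rot G d)) behind) (cyclic _ _)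

    orient-split-here : orient (rot d) (edge d) ≡ orient d (edge d)
    orient-split-here = orient-≡ (skip (mapˢ proj₂ second-part) (proj₂ (first d (edge d))))

    -- Both darts of such an edge lie in the same part of the tour, and exchanging the parts keeps
    -- the order within each.
    orient-split-uncut : ∀ x → side (source x) ≡ side (target x) →
                         orient (rot d) (edge x) ≡ orient d (edge x)
    orient-split-uncut x eq with edge x Fin.≟ edge d
    ... | yes p = subst (λ f → orient (rot d) f ≡ orient d f) (sym p) orient-split-here
    ... | no x≢d with side (source x) in sx
    ...   | true  = orient-≡ (skip (mapˢ (λ (y- , _) → off y-) second-part) (proj₂ (first d (edge x))))
      where
      off : ∀ {y} → side (source y) ≡ false → edge y ≢ edge x
      off {y} y- y≡x with same-edge x y y≡x
      ... | inj₁ refl = true≢false (trans (sym sx) y-)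
      ... | inj₂ refl = true≢false (trans eq y-)
    ...   | false = sym (orient-≡ (skip ((x≢d ∘ sym) ∷ mapˢ off first-part) (proj₂ (first (rot d) (edge x)))))
      where
      off : ∀ {y} → side (source y) ≡ true → edge y ≢ edge x
      off {y} y+ y≡x with same-edge x y y≡x
      ... | inj₁ refl = true≢false (trans (sym y+) sx)
      ... | inj₂ refl = true≢false (trans (sym y+) (sym eq))

    module _ (x : Dart) (x≢d : edge x ≢ edge d)
             (x+ : side (source x) ≡ true) (x- : side (target x) ≡ false) where

      -- Here the two darts lie in different parts, so the part that is toured first decides: the
      -- ahead part from `d`, the behind part from `rot d`.
      orient-split-cut : orient d (edge x) ≡ proj₂ x
      orient-split-cut with orient (next G T d) (edge x) Bool.≟ proj₂ x
      ... | yes eq = trans (sym (orient-next d x≢d)) eq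
      ... | no neq with first-in-stretch (proj₂ (first (next G T d) (edge x))) first-part
      ...   | inj₁ q = contradiction
          (trans (sym q) (trans (cong (λ b → side (source (edge x , b))) (Bool.¬-not neq)) x-)) true≢false
      ...   | inj₂ s = contradiction refl (loop-covers {Q = _≢ x} (λ eq → x≢d (sym (cong edge eq)))
          (mapˢ (_∘ cong edge) s ++ˢ mapˢ (λ { (y- , _) refl → true≢false (trans (sym x+) y-) }) second-part)
          (cyclic d x))

      orient-split-cut-rot : orient (rot d) (edge x) ≡ not (proj₂ x)
      orient-split-cut-rot with orient (rot d) (edge x) Bool.≟ not (proj₂ x)
      ... | yes eq = eq
      ... | no neq with first-in-stretch (proj₂ (first (rot d) (edge x))) second-part
      ...   | inj₁ (q , _) = contradiction
          (trans (sym x+) (trans (cong (λ b → side (source (edge x , b)))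
            (sym (trans (Bool.¬-not neq) (Bool.not-involutive _)))) q)) true≢false
      ...   | inj₂ s = contradiction refl (loop-covers {Q = _≢ flip x} (λ eq → x≢d (sym (cong edge eq)))
          (mapˢ (λ { y+ refl → true≢false (trans (sym y+) x-) }) first-part ++ˢ mapˢ (_∘ cong edge) s)
          (cyclic d (flip x)))

-- The complementary tree in the dual

lookup-∁ : ∀ {m} (T : Subset m) e → lookup (∁ T) e ≡ not (lookup T e)
lookup-∁ T e = lookup-map e not T

one-class : ∀ {n k} {T : Subset k} {s t : Fin k → Fin n} (Q : Quotient T s t) →
            (∀ u w → Quotient.class Q u ≡ Quotient.class Q w) → n ℕ.≤ suc ∣ T ∣
one-class {T = T} Q const = ℕ.≤-trans bound (ℕ.+-monoˡ-≤ ∣ T ∣ (subsingleton size λ x y →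
  let u , u↦x = class-surjective x ; w , w↦y = class-surjective y
  in trans (sym u↦x) (trans (const u w) w↦y)))
  where
  open Quotient Q
  subsingleton : ∀ k → ((x y : Fin k) → x ≡ y) → k ℕ.≤ 1
  subsingleton zero          _  = ℕ.z≤n
  subsingleton (suc zero)    _  = ℕ.≤-refl
  subsingleton (suc (suc _)) eq with () ← eq zero (suc zero)

module _ {n m} {src : DartOf m → Fin n} where

  tree-bound : {T : Subset m} → Tree src T → n ℕ.≤ suc ∣ T ∣
  tree-bound {T} tree = one-class (quotientᵈ src T) λ u w →
    Tree.induction tree (λ v → Quotient.class (quotientᵈ src T) u ≡ Quotient.class (quotientᵈ src T) v)
      (λ d d∈T eq → trans eq (identifiesᵈ src T d d∈T)) refl

module _ (G : RibbonGraph) (P : Planar G) where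
  open RibbonGraph G
  open Planar P

  -- Going round a dual face is `flip ∘ flip ∘ rot`, which is `rot`, so dual faces are vertices. A
  -- vertex without darts would be a spurious face; hence `inhabited`.
  dual-planar : (∀ u → ∃ λ d → source d ≡ u) → Planar (dual G P)
  dual-planar inhabited = record
    { nF            = nV
    ; left          = source
    ; left-orbits   = λ d x → mk⇔
        (λ eq → let k , d↦x = Equivalence.to (rot-orbits d x) eq in k , trans (folds d k) d↦x)
        (λ (k , d↦x) → Equivalence.from (rot-orbits d x) (k , trans (sym (folds d k)) d↦x))
    ; face-nonempty = λ _ → inhabited
    ; euler         = trans (ℕ.+-comm nF nV) euler
    }
    where
    folds : ∀ d k → fold d (flip ∘ (flip ∘ rot)) k ≡ fold d rot k
    folds d zero    = refl
    folds d (suc k) = trans (flip-flip (rot _)) (cong rot (folds d k))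

  left-flip-rot : ∀ d → left (flip (rot d)) ≡ left d
  left-flip-rot d = source-rot (dual G P) d

  module DualTour (T : Subset nE) where
    private
      module W  = Walking G T
      module W* = Walking (dual G P) (∁ T)

    -- Walking along an edge in one graph is cutting through it in the other. The dual tour has to
    -- examine the reversed dart for the two rotations to match.
    next-dual : ∀ d → next (dual G P) (∁ T) (flip d) ≡ flip (next G T d)
    next-dual d with lookup T (edge d) in d?
    ... | true  = W*.next-out (flip d) (trans (lookup-∁ T _) (cong not d?))
    ... | false = trans (W*.next-in (flip d) (trans (lookup-∁ T _) (cong not d?)))
                        (cong (flip ∘ rot) (flip-flip d))

    first-dual : ∀ {s f b} → W.First s f b → W*.First (flip s) f (not b)
    first-dual W.here                  = W*.here
    first-dual (W.there {d = d} d≢f p) = W*.there d≢f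
      (subst (λ x → W*.First x _ _) (sym (next-dual d)) (first-dual p))

    reaches-dual : ∀ {d x} → W.Reaches d x → W*.Reaches (flip d) (flip x)
    reaches-dual W.[]                = W*.[]
    reaches-dual (W._∷_ {d = d} _ r) = tt W*.∷
      subst (λ y → W*.Reaches y _) (sym (next-dual d)) (reaches-dual r)

  -- The dual tour examines the same edges, so it connects all faces; that ∁ T
  -- contains no superfluous edge then follows from Euler's formula.
  dual-tree : Dart → ∀ {T} → Tree source T → Tree left (∁ T)
  dual-tree start {T} tree = record { induction = induction* ; cut = cut* }
    where
    module W* = Walking (dual G P) (∁ T)
    open DualTour T

    induction* : ∀ (Q : Fin nF → Set) →
                 (∀ d → lookup (∁ T) (edge d) ≡ true → Q (left d) → Q (left (flip d))) →
                 ∀ {F F′} → Q F → Q F′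
    induction* Q h {F} {F′} q
      with d , refl ← face-nonempty start F | x , refl ← face-nonempty start F′ =
      go (subst₂ W*.Reaches (flip-flip d) (flip-flip x)
           (reaches-dual (Tour.cyclic G tree (flip d) (flip x)))) q
      where
      go : ∀ {d x} → W*.Reaches d x → Q (left d) → Q (left x)
      go W*.[]                q = q
      go (W*._∷_ {d = d} _ r) q with lookup (∁ T) (edge d) in d?
      ... | true  = go r (subst Q (sym (left-flip-rot (flip d))) (h d d? q))
      ... | false = go r (subst Q (sym (left-flip-rot d)) q)

    -- `T` has at least `nV - 1` edges; if `∁ T` had `nF - 1` edges even without `e`, the two
    -- together would have at least `nV + nF - 1`, which is `nE + 1`.
    too-few : ∀ e → lookup (∁ T) e ≡ true → ¬ (nF ℕ.≤ suc ∣ ∁ T ∖ e ∣)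
    too-few e e∈ nF≤ = ℕ.<-irrefl refl (begin-strict
      nE ℕ.+ 1                 <⟨ ℕ.+-monoʳ-< nE ℕ.≤-refl ⟩
      nE ℕ.+ 2                 ≡⟨ euler ⟨
      nV ℕ.+ nF                ≤⟨ ℕ.+-mono-≤ (tree-bound tree)
                                   (ℕ.≤-trans nF≤ (x∈p⇒∣p-x∣<∣p∣ (lookup⇒[]= e (∁ T) e∈))) ⟩
      suc (∣ T ∣ ℕ.+ ∣ ∁ T ∣)  ≡⟨ cong (λ k → suc (∣ T ∣ ℕ.+ k)) (∣∁p∣≡n∸∣p∣ T) ⟩
      suc (∣ T ∣ ℕ.+ (nE ℕ.∸ ∣ T ∣)) ≡⟨ cong suc (ℕ.m+[n∸m]≡n (∣p∣≤n T)) ⟩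
      suc nE                 ≡⟨ ℕ.+-comm nE 1 ⟨
      nE ℕ.+ 1                 ∎)
      where open ℕ.≤-Reasoning

    cut* : ∀ d → lookup (∁ T) (edge d) ≡ true → Cut left (∁ T) d
    cut* d d∈ = record
      { side   = λ F → does (class F Fin.≟ class (left (flip d)))
      ; behind = dec-false (class (left d) Fin.≟ _) (too-few (edge d) d∈ ∘ one-class Q ∘ constant)
      ; ahead  = dec-true (class (left (flip d)) Fin.≟ _) refl
      ; uncut  = λ x x∈ x≢d → cong (λ c → does (c Fin.≟ class (left (flip d))))
          (identifiesᵈ left (∁ T ∖ edge d) x (trans (lookup-without (∁ T) x≢d) x∈))
      }
      where
      Q = quotientᵈ left (∁ T ∖ edge d)
      open Quotient Q
      constant : class (left d) ≡ class (left (flip d)) → ∀ F F′ → class F ≡ class F′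
      constant eq F F′ = induction* (λ F′ → class F ≡ class F′) (λ x x∈ F≡ → trans F≡ (crossing x x∈)) refl
        where
        crossing : ∀ x → lookup (∁ T) (edge x) ≡ true → class (left x) ≡ class (left (flip x))
        crossing x x∈ with edge x Fin.≟ edge d
        ... | no x≢d = identifiesᵈ left (∁ T ∖ edge d) x (trans (lookup-without (∁ T) x≢d) x∈)
        ... | yes x≡d with same-edge d x x≡d
        ...   | inj₁ refl = eq
        ...   | inj₂ refl = trans (sym eq) (cong (class ∘ left) (sym (flip-flip d)))

open ≡-Reasoning

-- Sums and chains

private
  module S = CommutativeMonoidSum ℤ.+-0-commutativeMonoid
  module R = SemiringSum ℤ.+-*-semiring

module _ {n : ℕ} where

  private variable
    f g : Fin n → ℤ

  ∑-cong : (∀ i → f i ≡ g i) → ∑ f ≡ ∑ g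
  ∑-cong = S.sum-cong-≗

  ∑-zero : (∀ i → f i ≡ 0ℤ) → ∑ f ≡ 0ℤ
  ∑-zero f≡0 = trans (∑-cong f≡0) (S.sum-replicate-zero n)

  ∑-+ : ∀ (f g : Fin n → ℤ) → (∑[ i ] f i + g i) ≡ ∑ f + ∑ g
  ∑-+ = S.∑-distrib-+

  ∑-*ˡ : ∀ c (f : Fin n → ℤ) → c * ∑ f ≡ (∑[ i ] c * f i)
  ∑-*ˡ = R.*-distribˡ-sum

  ∑-neg : ∀ (f : Fin n → ℤ) → (∑[ i ] - f i) ≡ - ∑ f
  ∑-neg f = begin
    (∑[ i ] - f i)          ≡⟨ ∑-cong (λ i → sym (ℤ.-1*i≡-i (f i))) ⟩
    (∑[ i ] ℤ.-1ℤ * f i)    ≡⟨ ∑-*ˡ ℤ.-1ℤ f ⟨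
    ℤ.-1ℤ * ∑ f             ≡⟨ ℤ.-1*i≡-i (∑ f) ⟩
    - ∑ f                   ∎

  ∑-- : ∀ (f g : Fin n → ℤ) → (∑[ i ] f i - g i) ≡ ∑ f - ∑ g
  ∑-- f g = trans (∑-+ f (-_ ∘ g)) (cong (∑ f +_) (∑-neg g))

∑-swap : ∀ {m n} (f : Fin m → Fin n → ℤ) → (∑[ i ] ∑[ j ] f i j) ≡ (∑[ j ] ∑[ i ] f i j)
∑-swap = S.∑-comm

∑-single : ∀ {n} {f : Fin n → ℤ} k → (∀ i → i ≢ k → f i ≡ 0ℤ) → ∑ f ≡ f k
∑-single {suc n} {f} zero    f≡0 = begin
  f zero + ∑ (f ∘ suc) ≡⟨ cong (f zero +_) (∑-zero λ i → f≡0 (suc i) λ ()) ⟩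
  f zero + 0ℤ          ≡⟨ ℤ.+-identityʳ _ ⟩
  f zero               ∎
∑-single {suc n} {f} (suc k) f≡0 = begin
  f zero + ∑ (f ∘ suc) ≡⟨ cong₂ _+_ (f≡0 zero λ ()) (∑-single k λ i i≢k → f≡0 (suc i) (i≢k ∘ Fin.suc-injective)) ⟩
  0ℤ + f (suc k)       ≡⟨ ℤ.+-identityˡ _ ⟩
  f (suc k)            ∎

∑-nonneg : ∀ {n} {f : Fin n → ℤ} → (∀ i → 0ℤ ≤ f i) → 0ℤ ≤ ∑ f
∑-nonneg {zero}  f≥0 = ℤ.≤-refl
∑-nonneg {suc n} f≥0 = ℤ.+-mono-≤ (f≥0 zero) (∑-nonneg (f≥0 ∘ suc))

∑-nonneg-zero : ∀ {n} {f : Fin n → ℤ} → (∀ i → 0ℤ ≤ f i) → ∑ f ≡ 0ℤ → ∀ i → f i ≡ 0ℤ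
∑-nonneg-zero {suc n} {f} f≥0 ∑≡0 zero    = ℤ.≤-antisym
  (subst₂ _≤_ (ℤ.+-identityʳ (f zero)) ∑≡0 (ℤ.+-monoʳ-≤ (f zero) (∑-nonneg (f≥0 ∘ suc)))) (f≥0 zero)
∑-nonneg-zero {suc n} {f} f≥0 ∑≡0 (suc i) = ∑-nonneg-zero (f≥0 ∘ suc)
  (trans (sym (ℤ.+-identityˡ _))
    (trans (cong (_+ ∑ (f ∘ suc)) (sym (∑-nonneg-zero f≥0 ∑≡0 zero))) ∑≡0)) i

⟦_⟧ : Bool → ℤ
⟦ b ⟧ = if b then 1ℤ else 0ℤ

δ : ∀ {n} → Fin n → Fin n → ℤ
δ v u = ⟦ does (v Fin.≟ u) ⟧

δ-same : ∀ {n} (v : Fin n) → δ v v ≡ 1ℤ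
δ-same v = cong ⟦_⟧ (dec-true (v Fin.≟ v) refl)

δ-diff : ∀ {n} {v u : Fin n} → v ≢ u → δ v u ≡ 0ℤ
δ-diff {v = v} {u} v≢u = cong ⟦_⟧ (dec-false (v Fin.≟ u) v≢u)

∑-δ : ∀ {n} (f : Fin n → ℤ) v → (∑[ u ] f u * δ v u) ≡ f v
∑-δ f v = trans
  (∑-single v λ u u≢v → trans (cong (f u *_) (δ-diff (u≢v ∘ sym))) (ℤ.*-zeroʳ (f u)))
  (trans (cong (f v *_) (δ-same v)) (ℤ.*-identityʳ (f v)))

module Chains (G : RibbonGraph) where
  open RibbonGraph G

  grad : (Vertex → ℤ) → Chain G
  grad f e = f (source (e , false)) - f (source (e , true))

  Δ≡∂grad : ∀ f u → Δ G f u ≡ ∂ G (grad f) u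
  Δ≡∂grad f u = ∑-cong λ e →
    lemma (δ (source (e , true)) u) (δ (source (e , false)) u) (f (source (e , true))) (f (source (e , false)))
    where
    lemma : ∀ δs δt s t → δs * (s - t) + δt * (t - s) ≡ (t - s) * (δt - δs)
    lemma = solve-∀

  ∂-cong : ∀ {c c′ : Chain G} → (∀ e → c e ≡ c′ e) → ∀ u → ∂ G c u ≡ ∂ G c′ u
  ∂-cong eq u = ∑-cong λ e → cong (_* (δ (source (e , false)) u - δ (source (e , true)) u)) (eq e)

  ∂-+ : ∀ c c′ u → ∂ G (λ e → c e + c′ e) u ≡ ∂ G c u + ∂ G c′ u
  ∂-+ c c′ u = trans (∑-cong λ e → ℤ.*-distribʳ-+ _ (c e) (c′ e)) (∑-+ {nE} _ _)

  ∂-- : ∀ c c′ u → ∂ G (λ e → c e - c′ e) u ≡ ∂ G c u - ∂ G c′ u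
  ∂-- c c′ u = trans (∑-cong λ e → lemma (c e) (c′ e) _) (∑-- {nE} _ _)
    where
    lemma : ∀ a b x → (a - b) * x ≡ a * x - b * x
    lemma = solve-∀

  ∂-zero : ∀ u → ∂ G (λ _ → 0ℤ) u ≡ 0ℤ
  ∂-zero u = ∑-zero λ e → ℤ.*-zeroˡ (δ (source (e , false)) u - δ (source (e , true)) u)

  grad-+ : ∀ f g e → grad (λ u → f u + g u) e ≡ grad f e + grad g e
  grad-+ f g e = lemma (f (source (e , false))) (g (source (e , false)))
                       (f (source (e , true))) (g (source (e , true)))
    where
    lemma : ∀ a b c d → (a + b) - (c + d) ≡ (a - c) + (b - d)
    lemma = solve-∀

  grad-- : ∀ f g e → grad (λ u → f u - g u) e ≡ grad f e - grad g e
  grad-- f g e = lemma (f (source (e , false))) (g (source (e , false)))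
                       (f (source (e , true))) (g (source (e , true)))
    where
    lemma : ∀ a b c d → (a - b) - (c - d) ≡ (a - c) - (b - d)
    lemma = solve-∀

  -- The adjointness of `∂` and `grad`. With the indicator of a set of vertices for `χ` it measures
  -- what a chain carries into that set.
  pairing : ∀ (χ : Vertex → ℤ) (c : Chain G) → (∑[ u ] χ u * ∂ G c u) ≡ (∑[ e ] c e * grad χ e)
  pairing χ c = begin
    (∑[ u ] χ u * ∂ G c u)
      ≡⟨ ∑-cong (λ u → ∑-*ˡ (χ u) λ e → c e * (δ (source (e , false)) u - δ (source (e , true)) u)) ⟩
    (∑[ u ] ∑[ e ] χ u * (c e * (δ (source (e , false)) u - δ (source (e , true)) u)))
      ≡⟨ ∑-swap (λ u e → χ u * (c e * (δ (source (e , false)) u - δ (source (e , true)) u))) ⟩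
    (∑[ e ] ∑[ u ] χ u * (c e * (δ (source (e , false)) u - δ (source (e , true)) u)))
      ≡⟨ ∑-cong per-edge ⟩
    (∑[ e ] c e * grad χ e) ∎
    where
    lemma : ∀ x a s t → x * (a * (t - s)) ≡ a * (x * t - x * s)
    lemma = solve-∀
    per-edge : ∀ e → (∑[ u ] χ u * (c e * (δ (source (e , false)) u - δ (source (e , true)) u))) ≡ c e * grad χ e
    per-edge e = begin
      (∑[ u ] χ u * (c e * (δ t u - δ s u)))               ≡⟨ ∑-cong (λ u → lemma (χ u) (c e) (δ s u) (δ t u)) ⟩
      (∑[ u ] c e * (χ u * δ t u - χ u * δ s u))           ≡⟨ ∑-*ˡ (c e) (λ u → χ u * δ t u - χ u * δ s u) ⟨
      c e * (∑[ u ] χ u * δ t u - χ u * δ s u)             ≡⟨ cong (c e *_) (∑-- (λ u → χ u * δ t u) _) ⟩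
      c e * ((∑[ u ] χ u * δ t u) - (∑[ u ] χ u * δ s u))  ≡⟨ cong (c e *_) (cong₂ _-_ (∑-δ χ t) (∑-δ χ s)) ⟩
      c e * (χ t - χ s)                                    ∎
      where
      t = source (e , false)
      s = source (e , true)

  module _ {T} (tree : Tree source T) where
    open Tree tree

    -- A chain prescribed on a tree is the gradient of the sum of its values
    -- times the indicators of the corresponding cuts.
    potential : ∀ (c : Chain G) → ∃ λ (h : Vertex → ℤ) → ∀ e → lookup T e ≡ true → grad h e ≡ c e
    potential c = h , h-grad
      where
      weight : ∀ e b → lookup T e ≡ b → Vertex → ℤ
      weight e true  e∈T u = c e * ⟦ Cut.side (cut (e , true) e∈T) u ⟧
      weight e false _   u = 0ℤ

      h : Vertex → ℤ
      h u = ∑[ e ] weight e (lookup T e) refl u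

      step-off : ∀ f → lookup T f ≡ true → ∀ e b (e? : lookup T e ≡ b) → e ≢ f →
                 weight e b e? (source (f , false)) - weight e b e? (source (f , true)) ≡ 0ℤ
      step-off f f∈T e true  e∈T e≢f = trans
        (cong (λ b → c e * ⟦ b ⟧ - c e * ⟦ Cut.side (cut (e , true) e∈T) (source (f , true)) ⟧)
              (sym (Cut.uncut (cut (e , true) e∈T) (f , true) f∈T (e≢f ∘ sym))))
        (ℤ.+-inverseʳ (c e * _))
      step-off f f∈T e false _   _   = refl

      step-on : ∀ f b (f? : lookup T f ≡ b) → b ≡ true →
                weight f b f? (source (f , false)) - weight f b f? (source (f , true)) ≡ c f
      step-on f true f∈T refl = trans
        (cong₂ (λ a b → c f * ⟦ a ⟧ - c f * ⟦ b ⟧)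
               (Cut.ahead (cut (f , true) f∈T)) (Cut.behind (cut (f , true) f∈T)))
        (lemma (c f))
        where
        lemma : ∀ x → x * 1ℤ - x * 0ℤ ≡ x
        lemma = solve-∀

      h-grad : ∀ f → lookup T f ≡ true → grad h f ≡ c f
      h-grad f f∈T = begin
        grad h f ≡⟨ ∑-- (λ e → weight e (lookup T e) refl (source (f , false))) _ ⟨
        (∑[ e ] weight e (lookup T e) refl (source (f , false)) - weight e (lookup T e) refl (source (f , true)))
          ≡⟨ ∑-single f (λ e → step-off f f∈T e (lookup T e) refl) ⟩
        weight f (lookup T f) refl (source (f , false)) - weight f (lookup T f) refl (source (f , true))
          ≡⟨ step-on f (lookup T f) refl f∈T ⟩
        c f ∎

    -- No other tree edge crosses the cut of a tree edge, so pairing the cycle with the indicator of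
    -- one side leaves only the coefficient of that edge.
    cycle-on-tree : ∀ (c : Chain G) → (∀ u → ∂ G c u ≡ 0ℤ) →
                    (∀ e → lookup T e ≡ false → c e ≡ 0ℤ) → ∀ e → c e ≡ 0ℤ
    cycle-on-tree c ∂c≡0 off f with lookup T f in f?
    ... | false = off f f?
    ... | true  = begin
      c f                           ≡⟨ ℤ.*-identityʳ (c f) ⟨
      c f * (1ℤ - 0ℤ)               ≡⟨ cong₂ (λ a b → c f * (⟦ a ⟧ - ⟦ b ⟧)) ahead behind ⟨
      c f * grad χ f                ≡⟨ ∑-single f vanish ⟨
      (∑[ e ] c e * grad χ e)       ≡⟨ pairing χ c ⟨
      (∑[ u ] χ u * ∂ G c u)        ≡⟨ ∑-zero (λ u → trans (cong (χ u *_) (∂c≡0 u)) (ℤ.*-zeroʳ (χ u))) ⟩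
      0ℤ                            ∎
      where
      open Cut (cut (f , true) f?)
      χ : Vertex → ℤ
      χ u = ⟦ side u ⟧
      vanish : ∀ e → e ≢ f → c e * grad χ e ≡ 0ℤ
      vanish e e≢f with lookup T e in e?
      ... | false = trans (cong (_* grad χ e) (off e e?)) (ℤ.*-zeroˡ (grad χ e))
      ... | true  = trans (cong (λ b → c e * (⟦ b ⟧ - χ (source (e , true)))) (sym (uncut (e , true) e? e≢f)))
                          (trans (cong (c e *_) (ℤ.+-inverseʳ (χ (source (e , true))))) (ℤ.*-zeroʳ (c e)))

-- Sums over darts, and cycles as dual coboundaries

∑ᵈ : ∀ {m} → (DartOf m → ℤ) → ℤ
∑ᵈ φ = ∑[ e ] φ (e , true) + φ (e , false)

_≟ᵈ_ : ∀ {m} → DecidableEquality (DartOf m)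
_≟ᵈ_ = Product.≡-dec Fin._≟_ Bool._≟_

∑ᵈ-single : ∀ {m} (φ : DartOf m → ℤ) z → (∀ x → x ≢ z → φ x ≡ 0ℤ) → ∑ᵈ φ ≡ φ z
∑ᵈ-single φ z@(e , b) off = trans
  (∑-single e λ f f≢e → cong₂ _+_ (off (f , true) (f≢e ∘ cong edge)) (off (f , false) (f≢e ∘ cong edge)))
  (at b refl)
  where
  at : ∀ b′ → b′ ≡ b → φ (e , true) + φ (e , false) ≡ φ (e , b′)
  at true  refl = trans (cong (φ (e , true) +_) (off (e , false) λ ())) (ℤ.+-identityʳ _)
  at false refl = trans (cong (_+ φ (e , false)) (off (e , true) λ ())) (ℤ.+-identityˡ _)

∑ᵈ-cong : ∀ {m} {φ ψ : DartOf m → ℤ} → (∀ x → φ x ≡ ψ x) → ∑ᵈ φ ≡ ∑ᵈ ψ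
∑ᵈ-cong eq = ∑-cong λ e → cong₂ _+_ (eq (e , true)) (eq (e , false))

∑ᵈ-swap : ∀ {m} (φ : DartOf m → DartOf m → ℤ) → ∑ᵈ (λ x → ∑ᵈ (φ x)) ≡ ∑ᵈ (λ y → ∑ᵈ (λ x → φ x y))
∑ᵈ-swap φ = begin
  (∑[ e ] (∑[ f ] φ (e , true) (f , true) + φ (e , true) (f , false))
        + (∑[ f ] φ (e , false) (f , true) + φ (e , false) (f , false)))
    ≡⟨ ∑-cong (λ e → ∑-+ (λ f → φ (e , true) (f , true) + φ (e , true) (f , false)) _) ⟨
  (∑[ e ] ∑[ f ] (φ (e , true) (f , true) + φ (e , true) (f , false))
               + (φ (e , false) (f , true) + φ (e , false) (f , false)))
    ≡⟨ ∑-swap (λ e f → (φ (e , true) (f , true) + φ (e , true) (f , false))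
               + (φ (e , false) (f , true) + φ (e , false) (f , false))) ⟩
  (∑[ f ] ∑[ e ] (φ (e , true) (f , true) + φ (e , true) (f , false))
               + (φ (e , false) (f , true) + φ (e , false) (f , false)))
    ≡⟨ ∑-cong (λ f → trans (∑-cong λ e → lemma (φ (e , true) (f , true)) _ _ _)
                           (∑-+ (λ e → φ (e , true) (f , true) + φ (e , false) (f , true)) _)) ⟩
  (∑[ f ] (∑[ e ] φ (e , true) (f , true) + φ (e , false) (f , true))
        + (∑[ e ] φ (e , true) (f , false) + φ (e , false) (f , false))) ∎
  where
  lemma : ∀ a b c d → (a + b) + (c + d) ≡ (a + c) + (b + d)
  lemma = solve-∀

-- Double counting over the graph of `π`, by rows and by columns.
∑ᵈ-bijection : ∀ {m} (π π⁻¹ : DartOf m → DartOf m) → (∀ x → π (π⁻¹ x) ≡ x) → (∀ x → π⁻¹ (π x) ≡ x) →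
               ∀ φ → ∑ᵈ (φ ∘ π) ≡ ∑ᵈ φ
∑ᵈ-bijection π π⁻¹ invˡ invʳ φ = begin
  ∑ᵈ (φ ∘ π)                             ≡⟨ ∑ᵈ-cong row ⟨
  ∑ᵈ (λ x → ∑ᵈ (λ y → ε x y))            ≡⟨ ∑ᵈ-swap ε ⟩
  ∑ᵈ (λ y → ∑ᵈ (λ x → ε x y))            ≡⟨ ∑ᵈ-cong column ⟩
  ∑ᵈ φ                                   ∎
  where
  ε : _ → _ → ℤ
  ε x y = if does (π x ≟ᵈ y) then φ y else 0ℤ
  ε-on : ∀ {x y} → π x ≡ y → ε x y ≡ φ y
  ε-on {x} {y} eq rewrite dec-true (π x ≟ᵈ y) eq = refl
  ε-off : ∀ {x y} → π x ≢ y → ε x y ≡ 0ℤ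
  ε-off {x} {y} neq rewrite dec-false (π x ≟ᵈ y) neq = refl
  row : ∀ x → ∑ᵈ (λ y → ε x y) ≡ φ (π x)
  row x = trans (∑ᵈ-single (ε x) (π x) λ y y≢ → ε-off (y≢ ∘ sym)) (ε-on refl)
  column : ∀ y → ∑ᵈ (λ x → ε x y) ≡ φ y
  column y = trans
    (∑ᵈ-single (λ x → ε x y) (π⁻¹ y) λ x x≢ → ε-off λ πx≡y → x≢ (trans (sym (invʳ x)) (cong π⁻¹ πx≡y)))
    (ε-on (invˡ y))

-- Finiteness makes the right inverse of rot two-sided.
module _ (G : RibbonGraph) where
  open RibbonGraph G

  private
    back : Dart → Dart
    back d = proj₁ (rot⁻¹ G d)

    back-injective : ∀ {d x} → back d ≡ back x → d ≡ x
    back-injective {d} {x} eq = trans (sym (proj₂ (rot⁻¹ G d))) (trans (cong rot eq) (proj₂ (rot⁻¹ G x)))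

    back-surjective : ∀ d → ∃ λ x → back x ≡ d
    back-surjective d with i , k , _ , eq ← dart-pigeonhole (fold d back) = fold d back k , sym (cancel i eq)
      where
      cancel : ∀ i → fold d back i ≡ fold d back (i ℕ.+ suc k) → d ≡ fold d back (suc k)
      cancel zero    eq = eq
      cancel (suc i) eq = cancel i (back-injective eq)

    back-rot : ∀ d → back (rot d) ≡ d
    back-rot d with x , refl ← back-surjective d = cong back (proj₂ (rot⁻¹ G x))

  ∑ᵈ-rot : ∀ φ → ∑ᵈ (φ ∘ rot) ≡ ∑ᵈ φ
  ∑ᵈ-rot = ∑ᵈ-bijection rot back (λ d → proj₂ (rot⁻¹ G d)) back-rot

module _ (G : RibbonGraph) (P : Planar G) where
  open RibbonGraph G
  open Planar P
  open Chains G
  private module Dual = Chains (dual G P)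

  -- Regrouped by darts, the boundary at `u` adds `h` over the faces left of the darts at `u` and
  -- subtracts it over those on their right. The face right of `rot x` is the one left of `x`, so
  -- the two sums agree.
  ∂-dual-grad : ∀ h u → ∂ G (Dual.grad h) u ≡ 0ℤ
  ∂-dual-grad h u = begin
    ∂ G (Dual.grad h) u
      ≡⟨ ∑-cong (λ e → lemma (h (left (e , true))) (h (left (e , false)))
                             (δ (source (e , true)) u) (δ (source (e , false)) u)) ⟩
    (∑[ e ] (φ (e , true) + φ (e , false)) - (ψ (e , true) + ψ (e , false)))
      ≡⟨ ∑-- (λ e → φ (e , true) + φ (e , false)) _ ⟩
    ∑ᵈ φ - ∑ᵈ ψ          ≡⟨ cong (λ z → ∑ᵈ φ - z) (∑ᵈ-rot G ψ) ⟨
    ∑ᵈ φ - ∑ᵈ (ψ ∘ rot)  ≡⟨ cong (λ z → ∑ᵈ φ - z) (∑ᵈ-cong λ x →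
                              cong₂ (λ v F → δ v u * h F) (source-rot G x) (left-flip-rot G P x)) ⟩
    ∑ᵈ φ - ∑ᵈ φ          ≡⟨ ℤ.+-inverseʳ (∑ᵈ φ) ⟩
    0ℤ                   ∎
    where
    φ ψ : Dart → ℤ
    φ x = δ (source x) u * h (left x)
    ψ x = δ (source x) u * h (left (flip x))
    lemma : ∀ ht hf δt δf → (hf - ht) * (δf - δt) ≡ (δt * ht + δf * hf) - (δt * hf + δf * ht)
    lemma = solve-∀

  -- The dual tree yields a potential matching `c` outside `T`; what remains is a cycle supported on
  -- `T`, hence zero.
  cycle⇒dual-grad : ∀ {T} → Tree source T → Tree left (∁ T) → ∀ (c : Chain G) → (∀ u → ∂ G c u ≡ 0ℤ) →
                    ∃ λ (h : Fin nF → ℤ) → ∀ e → c e ≡ Dual.grad h e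
  cycle⇒dual-grad {T} tree tree* c ∂c≡0 with h , h-grad ← Dual.potential tree* c =
    h , λ e → ℤ.i-j≡0⇒i≡j _ _ (cycle-on-tree tree (λ e → c e - Dual.grad h e)
      (λ u → trans (∂-- c (Dual.grad h) u) (cong₂ _-_ (∂c≡0 u) (∂-dual-grad h u)))
      (λ e e∉T → trans (cong (λ x → c e - x) (h-grad e (trans (lookup-∁ T e) (cong not e∉T))))
                       (ℤ.+-inverseʳ (c e)))
      e)

module Principality (G : RibbonGraph) where
  open RibbonGraph G
  open Chains G

  Principal : Divisor G → Set
  Principal D = ∃ λ (f : Vertex → ℤ) → ∀ u → D u ≡ ∂ G (grad f) u

  private variable
    D E : Divisor G

  linEquiv⇒principal : ∀ D E → LinEquiv G D E → Principal (λ u → D u - E u)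
  linEquiv⇒principal D E (f , eq) = f , λ u → trans (eq u) (Δ≡∂grad f u)

  principal-resp : (∀ u → D u ≡ E u) → Principal D → Principal E
  principal-resp D≡E (f , eq) = f , λ u → trans (sym (D≡E u)) (eq u)

  principal-0 : Principal (λ _ → 0ℤ)
  principal-0 = (λ _ → 0ℤ) , λ u → sym (∂-zero u)

  principal-+ : Principal D → Principal E → Principal (λ u → D u + E u)
  principal-+ (f , eq) (g , eq′) = (λ u → f u + g u) , λ u → trans (cong₂ _+_ (eq u) (eq′ u))
    (sym (trans (∂-cong (grad-+ f g) u) (∂-+ (grad f) (grad g) u)))

  principal-- : Principal D → Principal E → Principal (λ u → D u - E u)
  principal-- (f , eq) (g , eq′) = (λ u → f u - g u) , λ u → trans (cong₂ _-_ (eq u) (eq′ u))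
    (sym (trans (∂-cong (grad-- f g) u) (∂-- (grad f) (grad g) u)))

-- Orientations and Bernardi divisors

module Orientations (G : RibbonGraph) where
  open RibbonGraph G
  open Chains G

  outDivisor : (Edge → Bool) → Divisor G
  outDivisor X u = ∑[ f ] δ (source (f , X f)) u

  reorient : (Edge → Bool) → (Edge → Bool) → Chain G
  reorient X Y f = ⟦ X f ⟧ - ⟦ Y f ⟧

  outDivisor-- : ∀ X Y u → outDivisor X u - outDivisor Y u ≡ ∂ G (reorient Y X) u
  outDivisor-- X Y u = trans (sym (∑-- (λ f → δ (source (f , X f)) u) _)) (∑-cong λ f → per-edge f (X f) (Y f))
    where
    z : ∀ s t → 0ℤ ≡ 0ℤ * (t - s)
    z = solve-∀
    p : ∀ s t → t - s ≡ 1ℤ * (t - s)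
    p = solve-∀
    q : ∀ s t → s - t ≡ (0ℤ - 1ℤ) * (t - s)
    q = solve-∀
    at : Edge → Bool → ℤ
    at f b = δ (source (f , b)) u
    per-edge : ∀ f x y → δ (source (f , x)) u - δ (source (f , y)) u ≡
               (⟦ y ⟧ - ⟦ x ⟧) * (δ (source (f , false)) u - δ (source (f , true)) u)
    per-edge f true  true  = trans (ℤ.+-inverseʳ (at f true)) (z (at f true) (at f false))
    per-edge f false false = trans (ℤ.+-inverseʳ (at f false)) (z (at f true) (at f false))
    per-edge f true  false = q (at f true) (at f false)
    per-edge f false true  = p (at f true) (at f false)

  -- Following the darts (f , not (X f)) one gets from r to every vertex.
  RootedAt : Vertex → (Edge → Bool) → Set₁
  RootedAt r X = ∀ (P : Vertex → Set) → (∀ f → P (source (f , not (X f))) → P (source (f , X f))) →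
                 P r → ∀ u → P u

module BernardiDivisor (G : RibbonGraph) (inhabited : ∀ u → ∃ λ d → RibbonGraph.source G d ≡ u)
                       {T : Subset (RibbonGraph.nE G)} (tree : Tree (RibbonGraph.source G) T) where
  open RibbonGraph G
  open Chains G
  open Orientations G
  open Tour G tree

  bernardi≡ : ∀ s u → bernardi G s T u ≡ (∑[ f ] (if lookup T f then 0ℤ else δ (source (f , orient s f)) u))
  bernardi≡ s u = ∑-cong λ f → cong (λ m → if lookup T f then 0ℤ else maybe′ (λ d → δ (source d) u) 0ℤ m)
    (firstExamined≡ (proj₂ (first s f)))

  -- Tree edges point towards s, the others away from the end where they are
  -- first cut through.
  orientation : Dart → Edge → Bool
  orientation s f = if lookup T f then not (orient s f) else orient s f

  orientation-in : ∀ s f → lookup T f ≡ true → orientation s f ≡ not (orient s f)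
  orientation-in s f f∈T rewrite f∈T = refl

  -- Exactly one tree edge first enters a given vertex other than the start, by `entering` and
  -- `entering-unique`; none first enters the start.
  entries : ∀ s u → (∑[ f ] (if lookup T f then δ (target (f , orient s f)) u else 0ℤ)) ≡ 1ℤ - δ (source s) u
  entries s u with u Fin.≟ source s
  ... | yes refl = trans (∑-zero none) (sym (cong (λ z → 1ℤ - z) (δ-same u)))
    where
    none : ∀ f → (if lookup T f then δ (target (f , orient s f)) u else 0ℤ) ≡ 0ℤ
    none f with lookup T f in f?
    ... | false = refl
    ... | true  = δ-diff (not-entering-start (proj₂ (first s f)) f?)
  ... | no u≢s with d , refl ← inhabited u with f , b , f∈T , p , u≡ ← entering (cyclic s d) u≢s = begin
    (∑[ f ] (if lookup T f then δ (target (f , orient s f)) u else 0ℤ)) ≡⟨ ∑-single f others ⟩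
    (if lookup T f then δ (target (f , orient s f)) u else 0ℤ)
      ≡⟨ cong₂ (λ t b → if t then δ (target (f , b)) u else 0ℤ) f∈T (orient-≡ p) ⟩
    δ (target (f , b)) u  ≡⟨ cong (λ v → δ v u) (sym u≡) ⟩
    δ u u                 ≡⟨ δ-same u ⟩
    1ℤ                    ≡⟨ cong (λ z → 1ℤ - z) (δ-diff (u≢s ∘ sym)) ⟨
    1ℤ - δ (source s) u   ∎
    where
    others : ∀ e → e ≢ f → (if lookup T e then δ (target (e , orient s e)) u else 0ℤ) ≡ 0ℤ
    others e e≢f with lookup T e in e?
    ... | false = refl
    ... | true  = δ-diff λ eq → e≢f (entering-unique (proj₂ (first s e)) p e? f∈T (trans eq u≡))

  -- A tree edge points back out of the vertex that it first enters, so the tree edges add the sum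
  -- in `entries`, the same for all trees.
  bernardi-outDivisor : ∀ s u → bernardi G s T u ≡ outDivisor (orientation s) u - (1ℤ - δ (source s) u)
  bernardi-outDivisor s u = begin
    bernardi G s T u                    ≡⟨ bernardi≡ s u ⟩
    ∑ outside                           ≡⟨ lemma (∑ outside) (∑ inside) ⟩
    (∑ outside + ∑ inside) - ∑ inside   ≡⟨ cong (_- ∑ inside) (∑-+ outside inside) ⟨
    (∑[ f ] outside f + inside f) - ∑ inside
      ≡⟨ cong₂ _-_ (∑-cong split) (entries s u) ⟩
    outDivisor (orientation s) u - (1ℤ - δ (source s) u) ∎
    where
    outside inside : Edge → ℤ
    outside f = if lookup T f then 0ℤ else δ (source (f , orient s f)) u
    inside  f = if lookup T f then δ (target (f , orient s f)) u else 0ℤ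
    lemma : ∀ a b → a ≡ (a + b) - b
    lemma = solve-∀
    split : ∀ f → outside f + inside f ≡ δ (source (f , orientation s f)) u
    split f with lookup T f
    ... | true  = ℤ.+-identityˡ _
    ... | false = ℤ.+-identityʳ _

  orientation-rooted : ∀ s → RootedAt (source s) (orientation s)
  orientation-rooted s P closed Ps u with d , refl ← inhabited u = exploration P forward Ps (cyclic s d)
    where
    forward : ∀ {f b} → First s f b → lookup T f ≡ true → P (source (f , b)) → P (target (f , b))
    forward {f} {b} p f∈T Pf = subst (λ c → P (source (f , c))) X≡
      (closed f (subst (λ c → P (source (f , c))) (sym (trans (cong not X≡) (Bool.not-involutive b))) Pf))
      where
      X≡ : orientation s f ≡ not b
      X≡ = trans (orientation-in s f f∈T) (cong not (orient-≡ p))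

  orientation-here : ∀ d → orientation d (edge d) ≡ (if lookup T (edge d) then not (proj₂ d) else proj₂ d)
  orientation-here d rewrite orient-here d = refl

  orientation-next-here : ∀ d → orientation (next G T d) (edge d) ≡ not (orientation d (edge d))
  orientation-next-here d rewrite orient-here d | orient-next-here d = toggle (lookup T (edge d)) (proj₂ d)
    where
    toggle : ∀ t b → (if t then not (not b) else not b) ≡ not (if t then not b else b)
    toggle true  b = refl
    toggle false b = refl

  orientation-next : ∀ d {f} → f ≢ edge d → orientation (next G T d) f ≡ orientation d f
  orientation-next d f≢d rewrite orient-next d f≢d = refl

module _ (G : RibbonGraph) (inhabited : ∀ u → ∃ λ d → RibbonGraph.source G d ≡ u)
         {T T′ : Subset (RibbonGraph.nE G)}
         (tree : Tree (RibbonGraph.source G) T) (tree′ : Tree (RibbonGraph.source G) T′) where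
  open RibbonGraph G
  private
    module B  = BernardiDivisor G inhabited tree
    module B′ = BernardiDivisor G inhabited tree′
    module W = Walking G T

  -- Both tours examine `s` first, so its edge is directed along `s` if it is outside the tree and
  -- against `s` if inside. Hence the trees agree there and the tours take the same step, which
  -- reverses this one edge in both orientations; so the comparison continues round the tour.
  orientation-determines-tree : ∀ s → (∀ f → B.orientation s f ≡ B′.orientation s f) →
                                ∀ f → lookup T f ≡ lookup T′ f
  orientation-determines-tree s X≡X′ f = go X≡X′ (Tour.cyclic G tree s (f , true))
    where
    decide : ∀ {t t′ b} → (if t then not b else b) ≡ (if t′ then not b else b) → t ≡ t′
    decide {true}  {true}  _ = refl
    decide {false} {false} _ = refl
    decide {true}  {false} eq = contradiction (sym eq) (Bool.not-¬ refl)
    decide {false} {true}  eq = contradiction eq (Bool.not-¬ refl)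

    agree : ∀ {s} → (∀ f → B.orientation s f ≡ B′.orientation s f) → lookup T (edge s) ≡ lookup T′ (edge s)
    agree {s} eq = decide (trans (sym (B.orientation-here s)) (trans (eq (edge s)) (B′.orientation-here s)))

    go : ∀ {s x} → (∀ f → B.orientation s f ≡ B′.orientation s f) →
         W.Reaches s x → lookup T (edge x) ≡ lookup T′ (edge x)
    go eq W.[]                = agree eq
    go eq (W._∷_ {d = s} _ r) = go eq′ r
      where
      next≡ : next G T s ≡ next G T′ s
      next≡ = cong (λ t → if t then rot (flip s) else rot s) (agree eq)
      eq′ : ∀ f → B.orientation (next G T s) f ≡ B′.orientation (next G T s) f
      eq′ f = trans (toggled f) (cong (λ y → B′.orientation y f) (sym next≡))
        where
        toggled : ∀ f → B.orientation (next G T s) f ≡ B′.orientation (next G T′ s) f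
        toggled f with f Fin.≟ edge s
        ... | yes refl = trans (B.orientation-next-here s) (trans (cong not (eq f)) (sym (B′.orientation-next-here s)))
        ... | no  f≢s  = trans (B.orientation-next s f≢s) (trans (eq f) (sym (B′.orientation-next s f≢s)))

-- The maximum principle for rooted orientations

maximum : ∀ {n} (g : Fin n → ℤ) → Fin n → ∃ λ k → ∀ i → g i ≤ g k
maximum {suc zero}    g _ = zero , λ { zero → ℤ.≤-refl }
maximum {suc (suc n)} g _ with k , max ← maximum (g ∘ suc) zero with ℤ.≤-total (g zero) (g (suc k))
... | inj₁ g₀≤ = suc k , λ { zero → g₀≤ ; (suc i) → max i }
... | inj₂ ≤g₀ = zero , λ { zero → ℤ.≤-refl ; (suc i) → ℤ.≤-trans (max i) ≤g₀ }

module _ (G : RibbonGraph) where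
  open RibbonGraph G
  open Chains G
  open Orientations G

  private
    -- The contribution of an edge with values t, s of g at its ends to
    -- the degree on {g = M} of ∂ (grad g - reorient Y X).
    excess : ℤ → ℤ → ℤ → Bool → Bool → ℤ
    excess M t s x y = ((t - s) - (⟦ y ⟧ - ⟦ x ⟧)) * (⟦ does (t ℤ.≟ M) ⟧ - ⟦ does (s ℤ.≟ M) ⟧)

    -- The closure conditions of `RootedAt` at one edge: for `X` with the set where `g` is `M`, and
    -- for `Y` with its complement.
    Consistent : ℤ → (Bool → ℤ) → Bool → Bool → Set
    Consistent M g x y = (g (not x) ≡ M → g x ≡ M) × (g (not y) ≢ M → g y ≢ M)

    1≤- : ∀ {s t} → s < t → 1ℤ ≤ t - s
    1≤- {s} {t} s<t = subst (_≤ t - s) (lemma s) (ℤ.+-monoˡ-≤ (- s) (ℤ.i<j⇒suc[i]≤j s<t))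
      where
      lemma : ∀ s → (1ℤ + s) - s ≡ 1ℤ
      lemma = solve-∀

    -1≤ : ∀ x y → ℤ.-1ℤ ≤ ⟦ x ⟧ - ⟦ y ⟧
    -1≤ true  true  = ℤ.-≤+
    -1≤ true  false = ℤ.-≤+
    -1≤ false true  = ℤ.-≤- ℕ.z≤n
    -1≤ false false = ℤ.-≤+

    too-large : ∀ {k l} → 1ℤ ≤ k → 0ℤ ≤ l → k + l ≢ 0ℤ
    too-large 1≤k 0≤l eq with ℤ.+≤+ () ← subst (1ℤ ≤_) eq (ℤ.+-mono-≤ 1≤k 0≤l)

    false-true : ∀ {A : Set} x y → (x ≡ false → y ≡ true → A) → ∀ {k} → 1ℤ ≤ k →
                k + (⟦ x ⟧ - ⟦ y ⟧) ≡ 0ℤ → A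
    false-true false true  a _   _  = a refl refl
    false-true true  true  _ 1≤k eq = contradiction eq (too-large 1≤k (ℤ.+≤+ ℕ.z≤n))
    false-true true  false _ 1≤k eq = contradiction eq (too-large 1≤k (ℤ.+≤+ ℕ.z≤n))
    false-true false false _ 1≤k eq = contradiction eq (too-large 1≤k (ℤ.+≤+ ℕ.z≤n))

    -- Leaving the set where `g` is `M`, the integer `g` drops by at least 1, and the orientations
    -- can offset at most 1. Equality forces `X` to point out of the set and `Y` into it.
    excess-nonneg : ∀ {M} (g : Bool → ℤ) → (∀ b → g b ≤ M) → ∀ x y →
                    0ℤ ≤ excess M (g false) (g true) x y ×
                    (excess M (g false) (g true) x y ≡ 0ℤ → Consistent M g x y)
    excess-nonneg {M} g g≤M x y with g false ℤ.≟ M | g true ℤ.≟ M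
    ... | yes p | yes q = ℤ.≤-reflexive (sym (ℤ.*-zeroʳ (g false - g true - (⟦ y ⟧ - ⟦ x ⟧)))) ,
                          λ _ → (λ _ → all x) , λ ≢M → contradiction (all (not y)) ≢M
      where
      all : ∀ b → g b ≡ M
      all true  = q
      all false = p
    ... | no  p | no  q = ℤ.≤-reflexive (sym (ℤ.*-zeroʳ (g false - g true - (⟦ y ⟧ - ⟦ x ⟧)))) ,
                          λ _ → (λ ≡M → contradiction ≡M (none (not x))) , λ _ → none y
      where
      none : ∀ b → g b ≢ M
      none true  = q
      none false = p
    ... | yes p | no  q = subst (0ℤ ≤_) (sym E≡) (ℤ.+-mono-≤ 1≤k (-1≤ x y)) ,
                          λ E≡0 → false-true x y (λ { refl refl → (λ _ → p) , (λ _ → q) }) 1≤k (trans (sym E≡) E≡0)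
      where
      1≤k : 1ℤ ≤ g false - g true
      1≤k = 1≤- (subst (g true <_) (sym p) (ℤ.≤∧≢⇒< (g≤M true) q))
      lemma : ∀ t s x y → (t - s - (y - x)) * 1ℤ ≡ (t - s) + (x - y)
      lemma = solve-∀
      E≡ : (g false - g true - (⟦ y ⟧ - ⟦ x ⟧)) * 1ℤ ≡ (g false - g true) + (⟦ x ⟧ - ⟦ y ⟧)
      E≡ = lemma (g false) (g true) ⟦ x ⟧ ⟦ y ⟧
    ... | no  p | yes q = subst (0ℤ ≤_) (sym E≡) (ℤ.+-mono-≤ 1≤k (-1≤ y x)) ,
                          λ E≡0 → false-true y x (λ { refl refl → (λ _ → q) , (λ _ → p) }) 1≤k (trans (sym E≡) E≡0)
      where
      1≤k : 1ℤ ≤ g true - g false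
      1≤k = 1≤- (subst (g false <_) (sym q) (ℤ.≤∧≢⇒< (g≤M false) p))
      lemma : ∀ t s x y → (t - s - (y - x)) * (0ℤ - 1ℤ) ≡ (s - t) + (y - x)
      lemma = solve-∀
      E≡ : (g false - g true - (⟦ y ⟧ - ⟦ x ⟧)) * (0ℤ - 1ℤ) ≡ (g true - g false) + (⟦ y ⟧ - ⟦ x ⟧)
      E≡ = lemma (g false) (g true) ⟦ x ⟧ ⟦ y ⟧

  -- All edges at the boundary of the set where g is maximal are directed one
  -- way by X and the other way by Y, so one of them contradicts rootedness.
  rooted-potential-constant : ∀ {r X Y} → RootedAt r X → RootedAt r Y → (g : Vertex → ℤ) →
                              (∀ u → outDivisor X u - outDivisor Y u ≡ ∂ G (grad g) u) →
                              ∀ u w → g u ≡ g w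
  rooted-potential-constant {r} {X} {Y} rootedX rootedY g eq u w = trans (top u) (sym (top w))
    where
    k = proj₁ (maximum g r)
    M = g k
    g≤M : ∀ v → g v ≤ M
    g≤M = proj₂ (maximum g r)

    χ : Vertex → ℤ
    χ v = ⟦ does (g v ℤ.≟ M) ⟧

    E : Edge → ℤ
    E e = excess M (g (source (e , false))) (g (source (e , true))) (X e) (Y e)

    E≥0 : ∀ e → 0ℤ ≤ E e × (E e ≡ 0ℤ → Consistent M (λ b → g (source (e , b))) (X e) (Y e))
    E≥0 e = excess-nonneg (λ b → g (source (e , b))) (λ b → g≤M _) (X e) (Y e)

    balanced : ∀ v → ∂ G (λ e → grad g e - reorient Y X e) v ≡ 0ℤ
    balanced v = trans (∂-- (grad g) (reorient Y X) v)
      (ℤ.i≡j⇒i-j≡0 (trans (sym (eq v)) (outDivisor-- X Y v)))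

    ∑E≡0 : ∑ E ≡ 0ℤ
    ∑E≡0 = begin
      ∑ E                                          ≡⟨ pairing χ (λ e → grad g e - reorient Y X e) ⟨
      (∑[ v ] χ v * ∂ G (λ e → grad g e - reorient Y X e) v)
        ≡⟨ ∑-zero (λ v → trans (cong (χ v *_) (balanced v)) (ℤ.*-zeroʳ (χ v))) ⟩
      0ℤ                                           ∎

    consistent : ∀ e → Consistent M (λ b → g (source (e , b))) (X e) (Y e)
    consistent e = proj₂ (E≥0 e) (∑-nonneg-zero (proj₁ ∘ E≥0) ∑E≡0 e)

    top : ∀ v → g v ≡ M
    top v with g r ℤ.≟ M
    ... | yes gr≡M = rootedX (λ v → g v ≡ M) (proj₁ ∘ consistent) gr≡M v
    ... | no  gr≢M = contradiction refl (rootedY (λ v → g v ≢ M) (proj₂ ∘ consistent) gr≢M k)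

-- Moving the start of the tour

module PlanarTree (G : RibbonGraph) (P : Planar G) (inhabited : ∀ u → ∃ λ d → RibbonGraph.source G d ≡ u)
                  {T : Subset (RibbonGraph.nE G)} (tree : Tree (RibbonGraph.source G) T)
                  (tree* : Tree (Planar.left P) (∁ T)) where
  open RibbonGraph G
  open Planar P
  open Chains G
  open Principality G
  open Tour G tree
  open BernardiDivisor G inhabited tree public
  private
    module Dual = Tour (dual G P) tree*

    off-tree : ∀ {f} → lookup T f ≡ false → lookup (∁ T) f ≡ true
    off-tree {f} f∉T = trans (lookup-∁ T f) (cong not f∉T)

  orient-dual : ∀ s f → Dual.orient (flip s) f ≡ not (orient s f)
  orient-dual s f = Dual.orient-≡ (DualTour.first-dual G P T (proj₂ (first s f)))

  orientation-dual : ∀ (inhabited* : ∀ F → ∃ λ d → left d ≡ F) s f →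
                     BernardiDivisor.orientation (dual G P) inhabited* tree* (flip s) f ≡ orientation s f
  orientation-dual _ s f rewrite lookup-∁ T f | orient-dual s f = swap (lookup T f) (orient s f)
    where
    swap : ∀ t b → (if not t then not (not b) else not b) ≡ (if t then not b else b)
    swap true  b = refl
    swap false b = Bool.not-involutive b

  value : Dart → Vertex → Edge → ℤ
  value s u f = if lookup T f then 0ℤ else δ (source (f , orient s f)) u

  value-cong : ∀ {s s′} → (∀ f → lookup T f ≡ false → orient s f ≡ orient s′ f) →
               ∀ u f → value s u f ≡ value s′ u f
  value-cong eq u f with lookup T f in f?
  ... | true  = refl
  ... | false = cong (λ b → δ (source (f , b)) u) (eq f f?)

  bernardi-cong : ∀ {s s′} → (∀ f → lookup T f ≡ false → orient s f ≡ orient s′ f) →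
                  ∀ u → bernardi G s T u ≡ bernardi G s′ T u
  bernardi-cong {s} {s′} eq u = begin
    bernardi G s T u     ≡⟨ bernardi≡ s u ⟩
    ∑ (value s u)        ≡⟨ ∑-cong (value-cong eq u) ⟩
    ∑ (value s′ u)       ≡⟨ bernardi≡ s′ u ⟨
    bernardi G s′ T u    ∎

  -- If `d` is in the tree, this is a step of the tour and only a tree edge changes direction.
  -- Otherwise it exchanges the two parts of the dual tour at the dual tree edge `flip d`. The edges
  -- outside `T` form the dual tree, so none but that of `d` crosses the dual cut, and that one
  -- keeps its direction.
  bernardi-rot-flip : ∀ d u → bernardi G (rot (flip d)) T u ≡ bernardi G d T u
  bernardi-rot-flip d with lookup T (edge d) in d?
  ... | true = bernardi-cong λ f f∉T →
    subst (λ x → orient x f ≡ orient d f) (next-in d d?)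
      (orient-next d λ { refl → true≢false (trans (sym d?) f∉T) })
  ... | false = bernardi-cong λ f f∉T → Bool.not-injective (begin
    not (orient (rot (flip d)) f)           ≡⟨ orient-dual (rot (flip d)) f ⟨
    Dual.orient (flip (rot (flip d))) f     ≡⟨ unchanged f f∉T ⟩
    Dual.orient (flip d) f                  ≡⟨ orient-dual d f ⟩
    not (orient d f)                        ∎)
    where
    C = Tree.cut tree* (flip d) (off-tree d?)
    open Dual.Split (flip d) (off-tree d?) C
    unchanged : ∀ f → lookup T f ≡ false → Dual.orient (flip (rot (flip d))) f ≡ Dual.orient (flip d) f
    unchanged f f∉T with f Fin.≟ edge d
    ... | yes refl = orient-split-here
    ... | no  f≢d  = orient-split-uncut (f , true) (Cut.uncut C (f , true) (off-tree f∉T) f≢d)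

  private
    Shift : Dart → Divisor G
    Shift d u = δ (target d) u - δ (source d) u

  bernardi-rot-out : ∀ d → lookup T (edge d) ≡ false → ∀ u →
                     bernardi G (rot d) T u - bernardi G d T u ≡ Shift d u
  bernardi-rot-out d d∉T u = begin
    bernardi G (rot d) T u - bernardi G d T u ≡⟨ cong (λ x → bernardi G x T u - bernardi G d T u) (next-out d d∉T) ⟨
    bernardi G d⁺ T u - bernardi G d T u      ≡⟨ cong₂ _-_ (bernardi≡ d⁺ u) (bernardi≡ d u) ⟩
    ∑ (value d⁺ u) - ∑ (value d u)            ≡⟨ ∑-- (value d⁺ u) (value d u) ⟨
    (∑[ f ] value d⁺ u f - value d u f)       ≡⟨ ∑-single (edge d) off ⟩
    value d⁺ u (edge d) - value d u (edge d)  ≡⟨ cong₂ _-_ (at (orient-next-here d)) (at (orient-here d)) ⟩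
    Shift d u                                 ∎
    where
    d⁺ = next G T d
    off : ∀ f → f ≢ edge d → value d⁺ u f - value d u f ≡ 0ℤ
    off f f≢d = ℤ.i≡j⇒i-j≡0 (cong (λ b → if lookup T f then 0ℤ else δ (source (f , b)) u) (orient-next d f≢d))
    at : ∀ {s b} → orient s (edge d) ≡ b → value s u (edge d) ≡ δ (source (edge d , b)) u
    at refl rewrite d∉T = refl

  -- The edges outside the tree that cross the cut of `d` pass from their ahead ends to their behind
  -- ends. This cancels their share in the boundary of the gradient, and only the share of `d`
  -- itself remains.
  bernardi-rot-in : ∀ d → lookup T (edge d) ≡ true → (C : Cut source T d) → ∀ u →
                    (bernardi G (rot d) T u - bernardi G d T u) + ∂ G (grad (λ v → ⟦ Cut.side C v ⟧)) u ≡ Shift d u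
  bernardi-rot-in d d∈T C u = begin
    (bernardi G (rot d) T u - bernardi G d T u) + ∑ across
      ≡⟨ cong (_+ ∑ across) (cong₂ _-_ (bernardi≡ (rot d) u) (bernardi≡ d u)) ⟩
    (∑ (value (rot d) u) - ∑ (value d u)) + ∑ across
      ≡⟨ cong (_+ ∑ across) (∑-- (value (rot d) u) (value d u)) ⟨
    (∑[ f ] value (rot d) u f - value d u f) + ∑ across
      ≡⟨ ∑-+ (λ f → value (rot d) u f - value d u f) across ⟨
    (∑[ f ] (value (rot d) u f - value d u f) + across f)
      ≡⟨ ∑-single (edge d) off ⟩
    (value (rot d) u (edge d) - value d u (edge d)) + across (edge d)
      ≡⟨ cong (_+ across (edge d)) (cong₂ _-_ (none (rot d) (edge d) d∈T) (none d (edge d) d∈T)) ⟩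
    0ℤ + across (edge d)
      ≡⟨ ℤ.+-identityˡ _ ⟩
    across (edge d)
      ≡⟨ on d behind ahead ⟩
    Shift d u ∎
    where
    open Cut C
    open Split d d∈T C
    χ : Vertex → ℤ
    χ v = ⟦ side v ⟧
    at : Edge → Bool → ℤ
    at f b = δ (source (f , b)) u
    across : Edge → ℤ
    across f = grad χ f * (at f false - at f true)

    none : ∀ s f → lookup T f ≡ true → value s u f ≡ 0ℤ
    none s f f∈T rewrite f∈T = refl
    some : ∀ {s f b} → lookup T f ≡ false → orient s f ≡ b → value s u f ≡ at f b
    some f∉T refl rewrite f∉T = refl

    level : ∀ f → side (source (f , false)) ≡ side (source (f , true)) → across f ≡ 0ℤ
    level f eq rewrite eq = trans (cong (_* (at f false - at f true)) (ℤ.+-inverseʳ (χ (source (f , true)))))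
                                  (ℤ.*-zeroˡ (at f false - at f true))

    on : ∀ d → side (source d) ≡ false → side (target d) ≡ true → across (edge d) ≡ Shift d u
    on (e , true)  s- t+ rewrite s- | t+ = lemma (at e false) (at e true)
      where
      lemma : ∀ t s → (1ℤ - 0ℤ) * (t - s) ≡ t - s
      lemma = solve-∀
    on (e , false) s- t+ rewrite s- | t+ = lemma (at e false) (at e true)
      where
      lemma : ∀ s t → (0ℤ - 1ℤ) * (s - t) ≡ t - s
      lemma = solve-∀

    uncrossed : ∀ f → lookup T f ≡ false → ∀ x → orient (rot d) f ≡ orient d f →
                (value (rot d) u f - value d u f) + (⟦ x ⟧ - ⟦ x ⟧) * (at f false - at f true) ≡ 0ℤ
    uncrossed f f∉T x same rewrite some f∉T same | some {d} f∉T refl =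
      lemma (at f (orient d f)) ⟦ x ⟧ (at f false - at f true)
      where
      lemma : ∀ a b c → (a - a) + (b - b) * c ≡ 0ℤ
      lemma = solve-∀

    cancel : ∀ f → f ≢ edge d → lookup T f ≡ false →
             ∀ x y → side (source (f , false)) ≡ x → side (source (f , true)) ≡ y →
             (value (rot d) u f - value d u f) + (⟦ x ⟧ - ⟦ y ⟧) * (at f false - at f true) ≡ 0ℤ
    cancel f f≢d f∉T true false p q
      rewrite some f∉T (orient-split-cut-rot (f , false) f≢d p q) | some f∉T (orient-split-cut (f , false) f≢d p q) =
      lemma (at f false) (at f true)
      where
      lemma : ∀ s t → (t - s) + (1ℤ - 0ℤ) * (s - t) ≡ 0ℤ
      lemma = solve-∀
    cancel f f≢d f∉T false true p q
      rewrite some f∉T (orient-split-cut-rot (f , true) f≢d q p) | some f∉T (orient-split-cut (f , true) f≢d q p) =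
      lemma (at f false) (at f true)
      where
      lemma : ∀ s t → (s - t) + (0ℤ - 1ℤ) * (s - t) ≡ 0ℤ
      lemma = solve-∀
    cancel f f≢d f∉T true true p q =
      uncrossed f f∉T true (orient-split-uncut (f , true) (trans q (sym p)))
    cancel f f≢d f∉T false false p q =
      uncrossed f f∉T false (orient-split-uncut (f , true) (trans q (sym p)))

    off′ : ∀ f → f ≢ edge d → ∀ t → lookup T f ≡ t → (value (rot d) u f - value d u f) + across f ≡ 0ℤ
    off′ f f≢d true  f∈T = cong₂ _+_ (cong₂ _-_ (none (rot d) f f∈T) (none d f f∈T))
                                     (level f (sym (uncut (f , true) f∈T f≢d)))
    off′ f f≢d false f∉T = cancel f f≢d f∉T _ _ refl refl

    off : ∀ f → f ≢ edge d → (value (rot d) u f - value d u f) + across f ≡ 0ℤ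
    off f f≢d = off′ f f≢d _ refl

  -- What matters is that `Shift d` does not mention the tree: it drops out of the difference for
  -- two trees.
  bernardi-rot : ∀ d → Principal (λ u → (bernardi G (rot d) T u - bernardi G d T u) - Shift d u)
  bernardi-rot d with lookup T (edge d) in d?
  ... | false = principal-resp (λ u → sym (ℤ.i≡j⇒i-j≡0 (bernardi-rot-out d d? u))) principal-0
  ... | true  = principal-resp
    (λ u → trans (lemma (bernardi G (rot d) T u - bernardi G d T u) (∂ G (grad χ) u))
                 (cong (λ z → (bernardi G (rot d) T u - bernardi G d T u) - z) (bernardi-rot-in d d? C u)))
    (principal-- principal-0 (χ , λ u → refl))
    where
    C = Tree.cut tree d d?
    χ : Vertex → ℤ
    χ v = ⟦ Cut.side C v ⟧
    lemma : ∀ b a → 0ℤ - a ≡ b - (b + a)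
    lemma = solve-∀

-- Differences of Bernardi divisors of two trees

module TwoTrees (G : RibbonGraph) (P : Planar G) (inhabited : ∀ u → ∃ λ d → RibbonGraph.source G d ≡ u)
                {T T′ : Subset (RibbonGraph.nE G)}
                (tree : Tree (RibbonGraph.source G) T) (tree* : Tree (Planar.left P) (∁ T))
                (tree′ : Tree (RibbonGraph.source G) T′) (tree′* : Tree (Planar.left P) (∁ T′)) where
  open RibbonGraph G
  open Planar P
  open Principality G
  open Orientations G
  open Chains G
  private
    module B  = PlanarTree G P inhabited tree tree*
    module B′ = PlanarTree G P inhabited tree′ tree′*

  difference : Dart → Divisor G
  difference s u = bernardi G s T u - bernardi G s T′ u

  difference-outDivisor : ∀ s u → difference s u ≡ outDivisor (B.orientation s) u - outDivisor (B′.orientation s) u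
  difference-outDivisor s u = trans (cong₂ _-_ (B.bernardi-outDivisor s u) (B′.bernardi-outDivisor s u))
    (lemma (outDivisor (B.orientation s) u) (outDivisor (B′.orientation s) u) (1ℤ - δ (source s) u))
    where
    lemma : ∀ a b c → (a - c) - (b - c) ≡ a - b
    lemma = solve-∀

  difference-∂ : ∀ s u → difference s u ≡ ∂ G (reorient (B′.orientation s) (B.orientation s)) u
  difference-∂ s u = trans (difference-outDivisor s u) (outDivisor-- (B.orientation s) (B′.orientation s) u)

  -- The tour of `T` steps to `rot (flip d)` or to `rot d`. The first changes neither divisor and
  -- the second shifts both by the same class, whether or not `T′` contains the edge.
  start-independence : ∀ s s′ → Principal (λ u → difference s′ u - difference s u)
  start-independence s s′ = go (Tour.cyclic G tree s s′)
    where
    open Walking G T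
    one-step : ∀ d → Principal (λ u → difference (next G T d) u - difference d u)
    one-step d with lookup T (edge d)
    ... | true  = principal-resp
      (λ u → sym (ℤ.i≡j⇒i-j≡0 (cong₂ _-_ (B.bernardi-rot-flip d u) (B′.bernardi-rot-flip d u)))) principal-0
    ... | false = principal-resp
      (λ u → lemma (bernardi G (rot d) T u) (bernardi G d T u) (bernardi G (rot d) T′ u) (bernardi G d T′ u)
                   (δ (target d) u - δ (source d) u))
      (principal-- (B.bernardi-rot d) (B′.bernardi-rot d))
      where
      lemma : ∀ a b c d x → ((a - b) - x) - ((c - d) - x) ≡ (a - c) - (b - d)
      lemma = solve-∀
    go : ∀ {s s′} → Reaches s s′ → Principal (λ u → difference s′ u - difference s u)
    go {s} []                     = principal-resp (λ u → sym (ℤ.+-inverseʳ (difference s u))) principal-0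
    go {s} {s′} (_∷_ {d = d} _ r) = principal-resp
      (λ u → lemma (difference s′ u) (difference (next G T d) u) (difference d u)) (principal-+ (go r) (one-step d))
      where
      lemma : ∀ a b c → (a - b) + (b - c) ≡ a - c
      lemma = solve-∀

  -- The orientations differ by a chain with principal boundary.  The maximum
  -- principle in G makes it a cycle, hence a coboundary in the dual, and the
  -- maximum principle in the dual makes it vanish.
  bernardi-injective : ∀ s → Principal (difference s) → ∀ f → lookup T f ≡ lookup T′ f
  bernardi-injective s (g , diff≡) = orientation-determines-tree G inhabited tree tree′ s X≡Y
    where
    inhabited* = face-nonempty s
    module B*  = BernardiDivisor (dual G P) inhabited* tree*
    module B′* = BernardiDivisor (dual G P) inhabited* tree′*
    module Dual where
      open Chains (dual G P) public
      open Orientations (dual G P) public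
    X = B.orientation s
    Y = B′.orientation s
    X* = B*.orientation (flip s)
    Y* = B′*.orientation (flip s)

    grad-constant : ∀ (g : Vertex → ℤ) → (∀ u w → g u ≡ g w) → ∀ e → grad g e ≡ 0ℤ
    grad-constant g const e = ℤ.i≡j⇒i-j≡0 (const _ _)

    cycle : ∀ u → ∂ G (reorient Y X) u ≡ 0ℤ
    cycle u = begin
      ∂ G (reorient Y X) u             ≡⟨ difference-∂ s u ⟨
      difference s u                   ≡⟨ diff≡ u ⟩
      ∂ G (grad g) u                   ≡⟨ ∂-cong (grad-constant g (rooted-potential-constant G
                                            (B.orientation-rooted s) (B′.orientation-rooted s) g
                                            (λ v → trans (sym (difference-outDivisor s v)) (diff≡ v)))) u ⟩
      ∂ G (λ _ → 0ℤ) u                 ≡⟨ ∂-zero u ⟩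
      0ℤ                               ∎

    coboundary = cycle⇒dual-grad G P tree tree* (reorient Y X) cycle
    h = proj₁ coboundary

    reorient*≡ : ∀ e → Dual.reorient Y* X* e ≡ reorient Y X e
    reorient*≡ e = cong₂ (λ y x → ⟦ y ⟧ - ⟦ x ⟧)
      (B′.orientation-dual inhabited* s e) (B.orientation-dual inhabited* s e)

    h-constant : ∀ F F′ → h F ≡ h F′
    h-constant = rooted-potential-constant (dual G P)
      (B*.orientation-rooted (flip s)) (B′*.orientation-rooted (flip s)) h
      (λ F → trans (Dual.outDivisor-- X* Y* F) (Dual.∂-cong (λ e → trans (reorient*≡ e) (proj₂ coboundary e)) F))

    X≡Y : ∀ f → X f ≡ Y f
    X≡Y f = sym (⟦⟧-injective (ℤ.i-j≡0⇒i≡j _ _ (trans (proj₂ coboundary f) (ℤ.i≡j⇒i-j≡0 (h-constant _ _)))))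
      where
      ⟦⟧-injective : ∀ {x y} → ⟦ x ⟧ ≡ ⟦ y ⟧ → x ≡ y
      ⟦⟧-injective {true}  {true}  _ = refl
      ⟦⟧-injective {false} {false} _ = refl

subset-ext : ∀ {m} {A B : Subset m} → (∀ e → lookup A e ≡ lookup B e) → A ≡ B
subset-ext {A = A} {B} eq = trans (sym (tabulate∘lookup A)) (trans (tabulate-cong eq) (tabulate∘lookup B))

-- The two sides of the square, compared in the dual

open RibbonGraph using (nE; Dart)

theorem6p1 : (G : RibbonGraph) → Connected G → Loopless G → (P : Planar G) → Bridgeless G →
    (start : Dart G) (β : Pic⁰ G → Subset (nE G) → Subset (nE G)) →
    IsBernardiAction G start β →
    (start⋆ : Dart (dual G P))
    (β⋆ : Pic⁰ (dual G P) → Subset (nE (dual G P)) → Subset (nE (dual G P))) →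
    IsBernardiAction (dual G P) start⋆ β⋆ →
    ∀ γ γ⋆ → Ψ G P γ γ⋆ →
    ∀ T → SpanningTree G T →
    σ G P (β γ T) ≡ β⋆ γ⋆ (σ G P T)
theorem6p1 G connected _ P _ s β isβ s⋆ β⋆ isβ⋆ γ γ⋆ (c , γ~∂c , γ⋆~∂c) T T-tree =
  -- Injectivity in the dual reduces the equality of `∁ T′` and `W` to the equivalence of their
  -- Bernardi divisors at `s⋆`.
  subset-ext (TwoTrees.bernardi-injective H HP inhabited* t′* t′** w w* s⋆ equivalent)
  where
  open RibbonGraph G using (source; Vertex)
  open Planar P using (left; face-nonempty)
  H = dual G P
  module A  = IsBernardiAction isβ
  module A⋆ = IsBernardiAction isβ⋆
  T′ = β γ T
  W  = β⋆ γ⋆ (∁ T)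

  inhabited : ∀ u → ∃ λ d → source d ≡ u
  inhabited u with connected u (source s)
  ... | []         = s , refl
  ... | step d _ _ = d , refl
  inhabited* : ∀ F → ∃ λ d → left d ≡ F
  inhabited* = face-nonempty s
  HP : Planar H
  HP = dual-planar G P inhabited

  t  = spanningTree⇒tree G T-tree
  t′ = spanningTree⇒tree G (A.preserves γ T-tree)
  t*  = dual-tree G P s t
  t′* = dual-tree G P s t′
  w   = spanningTree⇒tree H (A⋆.preserves γ⋆ (tree⇒spanningTree H t*))
  t**  = dual-tree H HP s t*
  t′** = dual-tree H HP s t′*
  w*   = dual-tree H HP s w

  module G₂ = TwoTrees G P inhabited t′ t′* t t*
  module H₂ = TwoTrees H HP inhabited* t′* t′** t* t**
  module Pic  = Principality G
  module Pic* = Principality H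
  open Chains G
  open Orientations G
  module Dual = Chains H

  y : Chain G
  y = reorient (BernardiDivisor.orientation G inhabited t s) (BernardiDivisor.orientation G inhabited t′ s)

  ∂[y-c] : Pic.Principal (λ u → ∂ G y u - ∂ G c u)
  ∂[y-c] = Pic.principal-resp
    (λ u → trans (lemma (bernardi G s T′ u) (bernardi G s T u) (proj₁ γ u) (∂ G c u))
                 (cong (_- ∂ G c u) (G₂.difference-∂ s u)))
    (Pic.principal-+ (Pic.linEquiv⇒principal (bernardi G s T′) _ (proj₂ (A.translates γ T-tree)))
                     (Pic.linEquiv⇒principal (proj₁ γ) (∂ G c) γ~∂c))
    where
    lemma : ∀ a b g z → (a - (b + g)) + (g - z) ≡ (a - b) - z
    lemma = solve-∀

  g = proj₁ ∂[y-c]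

  -- The boundaries of `y` and `c` are equivalent through `g`; subtracting its gradient turns the
  -- difference into a cycle.
  z : Chain G
  z e = (y e - c e) - grad g e

  ∂z≡0 : ∀ u → ∂ G z u ≡ 0ℤ
  ∂z≡0 u = trans (∂-- (λ e → y e - c e) (grad g) u)
    (ℤ.i≡j⇒i-j≡0 (trans (∂-- y c u) (proj₂ ∂[y-c] u)))

  z-coboundary = cycle⇒dual-grad G P t t* z ∂z≡0
  h = proj₁ z-coboundary

  ∂*[y-c] : Pic*.Principal (λ F → ∂ H y F - ∂ H c F)
  ∂*[y-c] = h , λ F → begin
    ∂ H y F - ∂ H c F                           ≡⟨ Dual.∂-- y c F ⟨
    ∂ H (λ e → y e - c e) F                     ≡⟨ lemma (∂ H (λ e → y e - c e) F) ⟩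
    -- The vertices of the dual of `H` are those of `G`, so `grad g` is a gradient there and its
    -- boundary in `H` vanishes.
    ∂ H (λ e → y e - c e) F - 0ℤ                ≡⟨ cong (λ x → ∂ H (λ e → y e - c e) F - x) (∂-dual-grad H HP g F) ⟨
    ∂ H (λ e → y e - c e) F - ∂ H (grad g) F    ≡⟨ Dual.∂-- (λ e → y e - c e) (grad g) F ⟨
    ∂ H z F                                     ≡⟨ Dual.∂-cong (proj₂ z-coboundary) F ⟩
    ∂ H (Dual.grad h) F                         ∎
    where
    lemma : ∀ a → a ≡ a - 0ℤ
    lemma = solve-∀

  -- The dual tours parallel to those from `s` start at `flip s`; `start-independence` later moves
  -- this start to `s⋆`.
  dual-difference : ∀ F → H₂.difference (flip s) F ≡ ∂ H y F
  dual-difference F = trans (H₂.difference-∂ (flip s) F) (Dual.∂-cong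
    (λ e → cong₂ (λ a b → ⟦ a ⟧ - ⟦ b ⟧) (PlanarTree.orientation-dual G P inhabited t t* inhabited* s e)
                                         (PlanarTree.orientation-dual G P inhabited t′ t′* inhabited* s e)) F)

  -- Modulo principal divisors, `∁ T′` differs from `∁ T` by `∂ H y`, hence by `∂ H c`, hence by
  -- `γ⋆`; and `W` differs from `∁ T` by `γ⋆` as well.
  equivalent : Pic*.Principal (λ F → bernardi H s⋆ (∁ T′) F - bernardi H s⋆ W F)
  equivalent = Pic*.principal-resp
    (λ F → trans (cong (λ x → ((H₂.difference s⋆ F - H₂.difference (flip s) F) + (x - ∂ H c F))
                              - ((proj₁ γ⋆ F - ∂ H c F) + (bernardi H s⋆ W F - (bernardi H s⋆ (∁ T) F + proj₁ γ⋆ F))))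
                       (sym (dual-difference F)))
                 (lemma (bernardi H s⋆ (∁ T′) F) (bernardi H s⋆ (∁ T) F) (H₂.difference (flip s) F)
                        (∂ H c F) (proj₁ γ⋆ F) (bernardi H s⋆ W F)))
    (Pic*.principal--
      (Pic*.principal-+ (H₂.start-independence (flip s) s⋆) ∂*[y-c])
      (Pic*.principal-+ (Pic*.linEquiv⇒principal (proj₁ γ⋆) (∂ H c) γ⋆~∂c)
        (Pic*.linEquiv⇒principal (bernardi H s⋆ W) _ (proj₂ (A⋆.translates γ⋆ (tree⇒spanningTree H t*))))))
    where
    lemma : ∀ a b d z g w → (((a - b) - d) + (d - z)) - ((g - z) + (w - (b + g))) ≡ a - w
    lemma = solve-∀
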